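{- Fix integers $k \ge 2$ and $\ell \ge 1$. Then for every integer $n \ge \binom{k+\ell}{k-1} + \binom{k+\ell-1}{k-1}$ (with $r = n-\ell > k$), there is no primitive uniquely $K_{r}^{(k)}$-saturated $k$-uniform hypergraph on $n$ vertices, where $r = n - \ell$.
   Context: $K_r^{(k)}$ denotes the complete $k$-uniform hypergraph on $r$ vertices. A $k$-uniform hypergraph $H$ is uniquely $K_r^{(k)}$-saturated if $H$ contains no copy of $K_r^{(k)}$ (i.e., no $r$-set of vertices all of whose $k$-subsets are edges), and for every $k$-subset $S$ of $V(H)$ that is not an edge of $H$, the hypergraph $H+S$ contains exactly one copy of $K_r^{(k)}$. A vertex $v$ is dominating in $H$ if every $k$-subset of $V(H)$ containing $v$ is an edge of $H$. $H$ is primitive uniquely $K_r^{(k)}$-saturated if it is uniquely $K_r^{(k)}$-saturated and has no dominating vertex. -}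

module Defs where

open import Data.Nat using (ℕ)
open import Data.Fin using (Fin)
open import Data.Fin.Subset using (Subset; _⊆_; _∈_; ∣_∣)
open import Data.Product using (Σ; ∃; _×_)
open import Data.Sum using (_⊎_)
open import Relation.Nullary using (¬_)
open import Relation.Binary.PropositionalEquality using (_≡_)

-- A k-uniform hypergraph on vertex set Fin n: a predicate "is an edge" on
-- subsets of Fin n; only subsets of size k are ever consulted.
Hypergraph : ℕ → Set₁
Hypergraph n = Subset n → Set

IsClique : ∀ {n} → (k r : ℕ) → Hypergraph n → Subset n → Set
IsClique k r H R = ∣ R ∣ ≡ r × (∀ T → T ⊆ R → ∣ T ∣ ≡ k → H T)

ContainsK : ∀ {n} → (k r : ℕ) → Hypergraph n → Set
ContainsK k r H = ∃ λ R → IsClique k r H R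

addEdge : ∀ {n} → Hypergraph n → Subset n → Hypergraph n
addEdge H S T = H T ⊎ T ≡ S

-- exactly one copy of K_r^(k) (a copy of a complete hypergraph is determined
-- by its vertex set)
ExactlyOneK : ∀ {n} → (k r : ℕ) → Hypergraph n → Set
ExactlyOneK k r H = ∃ λ R → IsClique k r H R × (∀ R' → IsClique k r H R' → R' ≡ R)

UniquelySaturated : ∀ {n} → (k r : ℕ) → Hypergraph n → Set
UniquelySaturated {n} k r H =
  ¬ ContainsK k r H ×
  (∀ (S : Subset n) → ∣ S ∣ ≡ k → ¬ H S → ExactlyOneK k r (addEdge H S))

Dominating : ∀ {n} → (k : ℕ) → Hypergraph n → Fin n → Set
Dominating {n} k H v = ∀ (T : Subset n) → ∣ T ∣ ≡ k → v ∈ T → H T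

PrimitiveUniquelySaturated : ∀ {n} → (k r : ℕ) → Hypergraph n → Set
PrimitiveUniquelySaturated {n} k r H =
  UniquelySaturated k r H × (∀ (v : Fin n) → ¬ Dominating k H v)

{-# OPTIONS --safe #-}

-- Let G be the hypergraph of non-edges.  Unique saturation gives that no ℓ-set
-- is a transversal of G, while each F ∈ G is the only member missed by some ℓ-set;
-- having no dominating vertex means that G spans.  So G is (ℓ+1)-transversal-
-- critical, and the bound on n is Tuza's bound for the order of such hypergraphs.
--
-- Choose a family S of members of G, each with a private vertex, no two
-- becoming equal after removing a vertex from each, covering as many vertices
-- as possible.  If v is uncovered and v ∈ F ∈ G, then F arises from some block by
-- exchanging a private vertex p for v, and the exchange moves the hole from v to p.
-- For a block S i and its critical ℓ-set Z, criticality of G lets every hole slide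
-- into Z, so with h holes only ℓ-h points of Z are left to meet the blocks.  Removing
-- a private vertex from every block then leaves an intersecting set-pair system of
-- type (k-1, ℓ-h), whose length and union are bounded by Bollobás' inequality.
module Submission where

open import Defs
open import Data.Nat hiding (∣_-_∣)
open import Data.Nat.Properties
open import Data.Nat.Combinatorics using (_C_; nCk≡n!/k![n-k]!; k![n∸k]!∣n!; nCk+nC[k+1]≡[n+1]C[k+1]; nCn≡1)
open import Data.Nat.DivMod using (m*[n/m]≡n)
open import Data.Nat.Tactic.RingSolver using (solve-∀)
open import Data.Bool using (if_then_else_)
import Data.Bool.Properties as Bool
open import Data.Empty using (⊥-elim)
import Data.Empty as Empty
open import Data.Fin using (Fin; zero; suc)
import Data.Fin.Properties as Fin
open import Data.Fin.Subset using (Subset; inside; outside; _∈_; _∉_; _⊆_; _⊂_; _∪_; _∩_; _-_; ∁; ⁅_⁆; ⊤; ⊥; ∣_∣)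
open import Data.Fin.Subset.Properties
open import Data.Product using (∃; ∃₂; _×_; _,_; proj₁; proj₂)
open import Data.Sum using (_⊎_; inj₁; inj₂)
open import Data.Vec using ([]; _∷_; tabulate; here; there)
open import Data.Vec.Properties using (≡-dec; lookup∘tabulate; []=⇒lookup; lookup⇒[]=)
open import Algebra.Properties.CommutativeMonoid.Sum +-0-commutativeMonoid using (sum; sum-cong-≗; ∑-distrib-+; ∑-comm)
open import Algebra.Properties.Semiring.Sum +-*-semiring using (*-distribˡ-sum; *-distribʳ-sum)
open import Function using (_∘_)
open import Relation.Nullary using (¬_; Dec; yes; no; does; contradiction)
open import Relation.Nullary.Decidable using (dec-true; dec-false; _×-dec_; ¬?)
open import Relation.Binary.PropositionalEquality

private variable
  m n : ℕ

-- Removal, inclusion and comprehension for finite subsets.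

x∉p-x : ∀ (p : Subset n) x → x ∉ p - x
x∉p-x (inside ∷ p) zero ()
x∉p-x (outside ∷ p) zero ()
x∉p-x (_ ∷ p) (suc x) (there h) = x∉p-x p x h

x∈p-y⇒x∈p : ∀ (p : Subset n) {x y} → x ∈ p - y → x ∈ p
x∈p-y⇒x∈p p {y = y} = p─q⊆p p ⁅ y ⁆

x∈p-y⇒x≢y : ∀ (p : Subset n) {x y} → x ∈ p - y → x ≢ y
x∈p-y⇒x≢y p h refl = x∉p-x p _ h

x∈p⇒suc∣p-x∣≡∣p∣ : ∀ (p : Subset n) {x} → x ∈ p → suc ∣ p - x ∣ ≡ ∣ p ∣
x∈p⇒suc∣p-x∣≡∣p∣ (inside ∷ p) here = cong (suc ∘ ∣_∣) (p─⊥≡p p)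
x∈p⇒suc∣p-x∣≡∣p∣ (inside ∷ p) (there h) = cong suc (x∈p⇒suc∣p-x∣≡∣p∣ p h)
x∈p⇒suc∣p-x∣≡∣p∣ (outside ∷ p) (there h) = x∈p⇒suc∣p-x∣≡∣p∣ p h

∣p∣≡0⇒x∉p : ∀ (p : Subset n) {x} → ∣ p ∣ ≡ 0 → x ∉ p
∣p∣≡0⇒x∉p p e h with trans (x∈p⇒suc∣p-x∣≡∣p∣ p h) e
... | ()

p⊆q∧∣q∣≤∣p∣⇒q⊆p : ∀ (p q : Subset n) → p ⊆ q → ∣ q ∣ ≤ ∣ p ∣ → q ⊆ p
p⊆q∧∣q∣≤∣p∣⇒q⊆p p q p⊆q le {x} x∈q with x ∈? p
... | yes x∈p = x∈p
... | no x∉p = contradiction (p⊂q⇒∣p∣<∣q∣ (p⊆q , x , x∈q , x∉p)) (≤⇒≯ le)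

filter : {P : Fin n → Set} → (∀ x → Dec (P x)) → Subset n
filter P? = tabulate (does ∘ P?)

module _ {P : Fin n → Set} (P? : ∀ x → Dec (P x)) where

  ∈filter⁺ : ∀ {x} → P x → x ∈ filter P?
  ∈filter⁺ {x} px = lookup⇒[]= x _ (trans (lookup∘tabulate (does ∘ P?) x) (dec-true (P? x) px))

  ∈filter⁻ : ∀ {x} → x ∈ filter P? → P x
  ∈filter⁻ {x} h with P? x | trans (sym (lookup∘tabulate (does ∘ P?) x)) ([]=⇒lookup h)
  ... | yes px | _ = px
  ... | no _ | ()

-- Indicator functions and finite sums.

ind : {P : Set} → Dec P → ℕ
ind d = if does d then 1 else 0

ind-yes : {P : Set} (d : Dec P) → P → ind d ≡ 1
ind-yes d p rewrite dec-true d p = refl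

ind-no : {P : Set} (d : Dec P) → ¬ P → ind d ≡ 0
ind-no d ¬p rewrite dec-false d ¬p = refl

sum-mono : {f g : Fin n → ℕ} → (∀ i → f i ≤ g i) → sum f ≤ sum g
sum-mono {zero} h = z≤n
sum-mono {suc n} h = +-mono-≤ (h zero) (sum-mono (h ∘ suc))

sum-zero : {f : Fin n → ℕ} → (∀ i → f i ≡ 0) → sum f ≡ 0
sum-zero {zero} h = refl
sum-zero {suc n} h = cong₂ _+_ (h zero) (sum-zero (h ∘ suc))

sum-single : {f : Fin n → ℕ} (i : Fin n) → (∀ j → j ≢ i → f j ≡ 0) → sum f ≡ f i
sum-single {f = f} zero h =
  trans (cong (f zero +_) (sum-zero (λ j → h (suc j) λ ()))) (+-identityʳ _)
sum-single {f = f} (suc i) h =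
  cong₂ _+_ (h zero λ ()) (sum-single i (λ j j≢i → h (suc j) (j≢i ∘ Fin.suc-injective)))

sum-ind : (p : Subset n) → sum (λ x → ind (x ∈? p)) ≡ ∣ p ∣
sum-ind [] = refl
sum-ind (inside ∷ p) = cong suc (trans (sum-cong-≗ (λ x → shift x (x ∈? p))) (sum-ind p))
  where
  shift : ∀ x (d : Dec (x ∈ p)) → ind (suc x ∈? inside ∷ p) ≡ ind (x ∈? p)
  shift x (yes h) = trans (ind-yes (suc x ∈? inside ∷ p) (there h)) (sym (ind-yes (x ∈? p) h))
  shift x (no h) = trans (ind-no (suc x ∈? inside ∷ p) (h ∘ drop-there)) (sym (ind-no (x ∈? p) h))
sum-ind (outside ∷ p) = trans (sum-cong-≗ (λ x → shift x (x ∈? p))) (sum-ind p)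
  where
  shift : ∀ x (d : Dec (x ∈ p)) → ind (suc x ∈? outside ∷ p) ≡ ind (x ∈? p)
  shift x (yes h) = trans (ind-yes (suc x ∈? outside ∷ p) (there h)) (sym (ind-yes (x ∈? p) h))
  shift x (no h) = trans (ind-no (suc x ∈? outside ∷ p) (h ∘ drop-there)) (sym (ind-no (x ∈? p) h))

sum-ind-* : (p : Subset n) (c : ℕ) → sum (λ x → ind (x ∈? p) * c) ≡ ∣ p ∣ * c
sum-ind-* p c = trans (sym (*-distribʳ-sum c (λ x → ind (x ∈? p)))) (cong (_* c) (sum-ind p))

-- Rising factorials and permutation weights.

rising : ℕ → ℕ → ℕ
rising s zero = 1
rising s (suc d) = suc s * rising (suc s) d

!*rising : ∀ s d → s ! * rising s d ≡ (s + d) !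
!*rising s zero = trans (*-identityʳ (s !)) (cong _! (sym (+-identityʳ s)))
!*rising s (suc d) = begin
  s ! * (suc s * rising (suc s) d) ≡⟨ lem (s !) s (rising (suc s) d) ⟩
  suc s ! * rising (suc s) d       ≡⟨ !*rising (suc s) d ⟩
  (suc s + d) !                    ≡⟨ cong _! (sym (+-suc s d)) ⟩
  (s + suc d) !                    ∎
  where
  open ≡-Reasoning
  lem : ∀ f s r → f * (suc s * r) ≡ (suc s * f) * r
  lem = solve-∀

!*!*C : ∀ a b → a ! * b ! * ((a + b) C a) ≡ (a + b) !
!*!*C a b = begin
  a ! * b ! * ((a + b) C a)             ≡⟨ cong (λ t → a ! * t ! * ((a + b) C a)) (sym (m+n∸m≡n a b)) ⟩
  a ! * (a + b ∸ a) ! * ((a + b) C a)   ≡⟨ cong (a ! * (a + b ∸ a) ! *_) (nCk≡n!/k![n-k]! (m≤m+n a b)) ⟩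
  a ! * (a + b ∸ a) ! * _               ≡⟨ m*[n/m]≡n {{a !* (a + b ∸ a) !≢0}} (k![n∸k]!∣n! (m≤m+n a b)) ⟩
  (a + b) !                             ∎
  where open ≡-Reasoning

-- W a b is N! / C(a+b, a), the number of permutations of N points in which a
-- given a-set entirely precedes a given disjoint b-set.
module Weight (N a : ℕ) where

  W : ℕ → ℕ
  W b = a ! * b ! * rising (a + b) (N ∸ (a + b))

  W*C : ∀ b → a + b ≤ N → W b * ((a + b) C a) ≡ N !
  W*C b le = begin
    a ! * b ! * r * c            ≡⟨ lem (a ! * b !) r c ⟩
    a ! * b ! * c * r            ≡⟨ cong (_* r) (!*!*C a b) ⟩
    (a + b) ! * r                ≡⟨ !*rising (a + b) (N ∸ (a + b)) ⟩
    (a + b + (N ∸ (a + b))) !    ≡⟨ cong _! (m+[n∸m]≡n le) ⟩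
    N !                          ∎
    where
    open ≡-Reasoning
    r = rising (a + b) (N ∸ (a + b))
    c = (a + b) C a
    lem : ∀ x r c → x * r * c ≡ x * c * r
    lem = solve-∀

  W-zero : a ≤ N → W 0 ≡ N !
  W-zero le = begin
    W 0                         ≡⟨ sym (*-identityʳ (W 0)) ⟩
    W 0 * 1                     ≡⟨ cong (W 0 *_) (sym (trans (cong (_C a) (+-identityʳ a)) (nCn≡1 a))) ⟩
    W 0 * ((a + 0) C a)         ≡⟨ W*C 0 (subst (_≤ N) (sym (+-identityʳ a)) le) ⟩
    N !                         ∎
    where open ≡-Reasoning

  -- The ratio of consecutive binomials. In `average` it makes the gain `suc b * (W b - W (suc b))`
  -- from deleting points of `B` balance the loss `a * W (suc b)` from deleting points of `A`.
  W-step : ∀ b → a + suc b ≤ N → suc b * W b ≡ (a + suc b) * W (suc b)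
  W-step b le = begin
    suc b * (a ! * b ! * rising (a + b) (N ∸ (a + b)))
      ≡⟨ cong (λ t → suc b * (a ! * b ! * rising (a + b) t)) eq ⟩
    suc b * (a ! * b ! * (suc (a + b) * rising (suc (a + b)) d))
      ≡⟨ cong (λ t → suc b * (a ! * b ! * (t * rising t d))) (sym (+-suc a b)) ⟩
    suc b * (a ! * b ! * ((a + suc b) * rising (a + suc b) d))
      ≡⟨ lem b (a !) (b !) (a + suc b) (rising (a + suc b) d) ⟩
    (a + suc b) * W (suc b) ∎
    where
    open ≡-Reasoning
    d = N ∸ (a + suc b)
    eq : N ∸ (a + b) ≡ suc d
    eq = begin
      N ∸ (a + b)           ≡⟨ cong (_∸ (a + b)) (sym (m+[n∸m]≡n (subst (_≤ N) (+-suc a b) le))) ⟩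
      suc (a + b) + (N ∸ suc (a + b)) ∸ (a + b) ≡⟨ cong (_∸ (a + b)) (sym (+-suc (a + b) _)) ⟩
      (a + b) + suc (N ∸ suc (a + b)) ∸ (a + b) ≡⟨ m+n∸m≡n (a + b) _ ⟩
      suc (N ∸ suc (a + b)) ≡⟨ cong (λ t → suc (N ∸ t)) (sym (+-suc a b)) ⟩
      suc d ∎
    lem : ∀ b fa fb t r → suc b * (fa * fb * (t * r)) ≡ t * (fa * (suc b * fb) * r)
    lem = solve-∀

  W-antitone : ∀ {b c} → b ≤ c → a + c ≤ N → W c ≤ W b
  W-antitone {b} {c} b≤c le with m≤n⇒m<n∨m≡n b≤c
  ... | inj₂ refl = ≤-refl
  W-antitone {b} {suc c} b≤c le | inj₁ (s≤s b≤c') =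
    ≤-trans (*-cancelˡ-≤ (suc c) step) (W-antitone b≤c' (≤-trans (+-monoʳ-≤ a (n≤1+n c)) le))
    where
    step : suc c * W (suc c) ≤ suc c * W c
    step = subst (suc c * W (suc c) ≤_) (sym (W-step c le)) (*-monoˡ-≤ (W (suc c)) (m≤n+m (suc c) a))

-- Bollobás' inequality for set pairs.

IntersectingPairs : Subset m → (A B : Fin m → Subset n) → Set
IntersectingPairs J A B =
  (∀ i → i ∈ J → ∀ x → x ∈ A i → x ∉ B i) ×
  (∀ i j → i ∈ J → j ∈ J → i ≢ j → ∃ λ x → x ∈ A i × x ∈ B j)

-- The events "A i entirely precedes B i ∩ X" over the pairs with A i ⊆ X are disjoint
-- for a random permutation of X; averaging over the last point of X turns this into
-- an induction on ∣ X ∣.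
module _ {a b : ℕ} {J : Subset m} {A B : Fin m → Subset n}
         (∣A∣≡a : ∀ i → i ∈ J → ∣ A i ∣ ≡ a)
         (∣B∣≤b : ∀ i → i ∈ J → ∣ B i ∣ ≤ b)
         (pairs : IntersectingPairs J A B) where

  private
    -- `N` only scales the weights. This choice is at least `a + b` and every `a + ∣ B i ∩ X ∣`, so
    -- the truncated subtraction in `W` is exact whatever `a` and `b` are.
    N = n + (a + b)
    open Weight N a
    disjoint = proj₁ pairs
    cross = proj₂ pairs

    Active : Subset n → Fin m → Set
    Active X i = i ∈ J × A i ⊆ X

    active? : ∀ X i → Dec (Active X i)
    active? X i = (i ∈? J) ×-dec (A i ⊆? X)

    u : Subset n → Fin m → ℕ
    u X i = ind (active? X i) * W ∣ B i ∩ X ∣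

    u-inactive : ∀ X i → ¬ Active X i → u X i ≡ 0
    u-inactive X i h rewrite ind-no (active? X i) h = refl

    u-active : ∀ X i → Active X i → u X i ≡ W ∣ B i ∩ X ∣
    u-active X i h rewrite ind-yes (active? X i) h = *-identityˡ _

    size : ∀ X i → i ∈ J → a + ∣ B i ∩ X ∣ ≤ N
    size X i i∈J = ≤-trans (subst (_≤ n) (cong (_+ ∣ B i ∩ X ∣) (∣A∣≡a i i∈J)) le) (m≤m+n n (a + b))
      where
      A⊆∁ : A i ⊆ ∁ (B i ∩ X)
      A⊆∁ {x} x∈A = x∉p⇒x∈∁p λ h → disjoint i i∈J x x∈A (p∩q⊆p (B i) X h)
      le : ∣ A i ∣ + ∣ B i ∩ X ∣ ≤ n
      le = begin
        ∣ A i ∣ + ∣ B i ∩ X ∣          ≤⟨ +-monoˡ-≤ _ (p⊆q⇒∣p∣≤∣q∣ A⊆∁) ⟩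
        ∣ ∁ (B i ∩ X) ∣ + ∣ B i ∩ X ∣  ≡⟨ cong (_+ ∣ B i ∩ X ∣) (∣∁p∣≡n∸∣p∣ (B i ∩ X)) ⟩
        n ∸ ∣ B i ∩ X ∣ + ∣ B i ∩ X ∣  ≡⟨ m∸n+n≡m (∣p∣≤n (B i ∩ X)) ⟩
        n ∎
        where open ≤-Reasoning

    -- Deleting a point of `A i` kills the event, deleting one of `B i ∩ X` raises its weight to
    -- `W c`, and any other point of `X` leaves it alone. Both sides carry added terms so that no
    -- subtraction occurs; after summing over `x`, `W-step` cancels them.
    local : ∀ X i {c} → ∣ B i ∩ X ∣ ≡ suc c → Active X i → ∀ x →
      ind (x ∈? X) * u (X - x) i + (ind (x ∈? A i) * W (suc c) + ind (x ∈? B i ∩ X) * W (suc c))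
        ≡ ind (x ∈? X) * W (suc c) + ind (x ∈? B i ∩ X) * W c
    local X i {c} e (i∈J , A⊆X) x with x ∈? X | x ∈? A i | x ∈? B i ∩ X
    ... | no x∉X | yes x∈A | _ = contradiction (A⊆X x∈A) x∉X
    ... | no x∉X | no _ | yes x∈BX = contradiction (p∩q⊆q (B i) X x∈BX) x∉X
    ... | no x∉X | no _ | no _ = refl
    ... | yes x∈X | yes x∈A | yes x∈BX = contradiction (p∩q⊆p (B i) X x∈BX) (disjoint i i∈J x x∈A)
    ... | yes x∈X | yes x∈A | no _
      rewrite u-inactive (X - x) i (λ (_ , h) → x∉p-x X x (h x∈A)) = refl
    ... | yes x∈X | no x∉A | yes x∈BX =
      trans (cong (λ t → 1 * t + (0 + 1 * W (suc c))) eq) (lem (W c) (W (suc c)))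
      where
      set : B i ∩ (X - x) ≡ (B i ∩ X) - x
      set = ⊆-antisym
        (λ h → let (p , q) = x∈p∩q⁻ (B i) (X - x) h in
          x∈p∧x≢y⇒x∈p-y (x∈p∩q⁺ (p , x∈p-y⇒x∈p X q)) (x∈p-y⇒x≢y X q))
        (λ h → let (p , q) = x∈p∩q⁻ (B i) X (x∈p-y⇒x∈p (B i ∩ X) h) in
          x∈p∩q⁺ (p , x∈p∧x≢y⇒x∈p-y q (x∈p-y⇒x≢y (B i ∩ X) h)))
      eq : u (X - x) i ≡ W c
      eq = trans (u-active (X - x) i (i∈J , λ {y} y∈A → x∈p∧x≢y⇒x∈p-y (A⊆X y∈A) λ { refl → x∉A y∈A }))
                 (cong W (suc-injective (trans (trans (cong (suc ∘ ∣_∣) set) (x∈p⇒suc∣p-x∣≡∣p∣ (B i ∩ X) x∈BX)) e)))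
      lem : ∀ v w → 1 * v + (0 + 1 * w) ≡ 1 * w + 1 * v
      lem = solve-∀
    ... | yes x∈X | no x∉A | no x∉BX =
      trans (cong (λ t → 1 * t + 0) eq) refl
      where
      set : B i ∩ (X - x) ≡ B i ∩ X
      set = ⊆-antisym
        (λ h → let (p , q) = x∈p∩q⁻ (B i) (X - x) h in x∈p∩q⁺ (p , x∈p-y⇒x∈p X q))
        (λ h → let (p , q) = x∈p∩q⁻ (B i) X h in
          x∈p∩q⁺ (p , x∈p∧x≢y⇒x∈p-y q λ { refl → x∉BX h }))
      eq : u (X - x) i ≡ W (suc c)
      eq = trans (u-active (X - x) i (i∈J , λ {y} y∈A → x∈p∧x≢y⇒x∈p-y (A⊆X y∈A) λ { refl → x∉A y∈A }))
                 (cong W (trans (cong ∣_∣ set) e))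

    average : ∀ X → (∀ i → Active X i → ∣ B i ∩ X ∣ ≢ 0) → ∀ i →
      ∣ X ∣ * u X i ≡ sum (λ x → ind (x ∈? X) * u (X - x) i)
    average X nz i with active? X i
    ... | no h = trans (cong (∣ X ∣ *_) (u-inactive X i h)) (trans (*-zeroʳ ∣ X ∣) (sym (sum-zero λ x →
          trans (cong (ind (x ∈? X) *_) (u-inactive (X - x) i λ (i∈J , A⊆) → h (i∈J , x∈p-y⇒x∈p X ∘ A⊆)))
                (*-zeroʳ (ind (x ∈? X))))))
    ... | yes act = go ∣ B i ∩ X ∣ refl
      where
      go : ∀ c → ∣ B i ∩ X ∣ ≡ c → ∣ X ∣ * u X i ≡ sum (λ x → ind (x ∈? X) * u (X - x) i)
      go zero e = contradiction e (nz i act)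
      go (suc c) e = trans (cong (∣ X ∣ *_) (trans (u-active X i act) (cong W e))) (+-cancelʳ-≡ (a * w + suc c * w) (∣ X ∣ * w) T (begin
        ∣ X ∣ * w + (a * w + suc c * w)  ≡⟨ cong (∣ X ∣ * w +_) (sym (*-distribʳ-+ w a (suc c))) ⟩
        ∣ X ∣ * w + (a + suc c) * w      ≡⟨ cong (∣ X ∣ * w +_) (sym (W-step c (subst (λ t → a + t ≤ N) e (size X i (proj₁ act))))) ⟩
        ∣ X ∣ * w + suc c * W c          ≡⟨ cong₂ _+_ (sym (sum-ind-* X w)) (trans (cong (_* W c) (sym e)) (sym (sum-ind-* (B i ∩ X) (W c)))) ⟩
        sum (λ x → ind (x ∈? X) * w) + sum (λ x → ind (x ∈? B i ∩ X) * W c)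
          ≡⟨ sym (∑-distrib-+ (λ x → ind (x ∈? X) * w) (λ x → ind (x ∈? B i ∩ X) * W c)) ⟩
        sum (λ x → ind (x ∈? X) * w + ind (x ∈? B i ∩ X) * W c)
          ≡⟨ sum-cong-≗ (λ x → sym (local X i e act x)) ⟩
        sum (λ x → ind (x ∈? X) * u (X - x) i + (ind (x ∈? A i) * w + ind (x ∈? B i ∩ X) * w))
          ≡⟨ ∑-distrib-+ (λ x → ind (x ∈? X) * u (X - x) i) (λ x → ind (x ∈? A i) * w + ind (x ∈? B i ∩ X) * w) ⟩
        T + sum (λ x → ind (x ∈? A i) * w + ind (x ∈? B i ∩ X) * w)
          ≡⟨ cong (T +_) (∑-distrib-+ (λ x → ind (x ∈? A i) * w) (λ x → ind (x ∈? B i ∩ X) * w)) ⟩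
        T + (sum (λ x → ind (x ∈? A i) * w) + sum (λ x → ind (x ∈? B i ∩ X) * w))
          ≡⟨ cong (T +_) (cong₂ _+_ (trans (sum-ind-* (A i) w) (cong (_* w) (∣A∣≡a i (proj₁ act))))
                                    (trans (sum-ind-* (B i ∩ X) w) (cong (_* w) e))) ⟩
        T + (a * w + suc c * w) ∎))
        where
        open ≡-Reasoning
        w = W (suc c)
        T = sum (λ x → ind (x ∈? X) * u (X - x) i)

    a≤N : a ≤ N
    a≤N = ≤-trans (m≤m+n a b) (m≤n+m (a + b) n)

    -- If an active pair has `B i ∩ X` empty, it is the only active pair, since any other active
    -- `A j` would meet `B i` inside `X`, and its weight is `N !`. Otherwise `average` reduces the
    -- sum for `X` to those for the sets `X - x`.
    total : ∀ k X → ∣ X ∣ ≡ k → sum (u X) ≤ N !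
    total k X e with Fin.any? (λ i → active? X i ×-dec (∣ B i ∩ X ∣ ≟ 0))
    ... | yes (i , act , z) = ≤-reflexive (begin
      sum (u X)      ≡⟨ sum-single i (λ j j≢i → u-inactive X j λ (j∈J , A⊆X) →
                          let (x , x∈A , x∈B) = cross j i j∈J (proj₁ act) j≢i in
                          ∣p∣≡0⇒x∉p (B i ∩ X) z (x∈p∩q⁺ (x∈B , A⊆X x∈A))) ⟩
      u X i          ≡⟨ u-active X i act ⟩
      W ∣ B i ∩ X ∣  ≡⟨ cong W z ⟩
      W 0            ≡⟨ W-zero a≤N ⟩
      N ! ∎)
      where open ≡-Reasoning
    total zero X e | no h = subst (_≤ N !) (sym (sum-zero λ i → u-inactive X i λ act →
      h (i , act , n≤0⇒n≡0 (subst (∣ B i ∩ X ∣ ≤_) e (∣p∩q∣≤∣q∣ (B i) X))))) z≤n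
    total (suc k) X e | no h = *-cancelˡ-≤ (suc k) (begin
      suc k * sum (u X)                         ≡⟨ cong (_* sum (u X)) (sym e) ⟩
      ∣ X ∣ * sum (u X)                         ≡⟨ *-distribˡ-sum ∣ X ∣ (u X) ⟩
      sum (λ i → ∣ X ∣ * u X i)                 ≡⟨ sum-cong-≗ (average X λ i act z → h (i , act , z)) ⟩
      sum (λ i → sum (λ x → ind (x ∈? X) * u (X - x) i))
        ≡⟨ ∑-comm (λ i x → ind (x ∈? X) * u (X - x) i) ⟩
      sum (λ x → sum (λ i → ind (x ∈? X) * u (X - x) i))
        ≡⟨ sum-cong-≗ (λ x → sym (*-distribˡ-sum (ind (x ∈? X)) (u (X - x)))) ⟩
      sum (λ x → ind (x ∈? X) * sum (u (X - x))) ≤⟨ sum-mono bound ⟩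
      sum (λ x → ind (x ∈? X) * N !)            ≡⟨ sum-ind-* X (N !) ⟩
      ∣ X ∣ * N !                               ≡⟨ cong (_* N !) e ⟩
      suc k * N ! ∎)
      where
      open ≤-Reasoning
      bound : ∀ x → ind (x ∈? X) * sum (u (X - x)) ≤ ind (x ∈? X) * N !
      bound x with x ∈? X
      ... | no _ = z≤n
      ... | yes x∈X = *-monoʳ-≤ 1 (total k (X - x) (suc-injective (trans (x∈p⇒suc∣p-x∣≡∣p∣ X x∈X) e)))

  -- Over the full ground set every pair of `J` is active with weight at least `W b`, and these
  -- weights add up to at most `N !`, which is `W b` times the binomial.
  bollobás : ∣ J ∣ ≤ (a + b) C a
  bollobás = *-cancelˡ-≤ (W b) {{W≢0}} (begin
    W b * ∣ J ∣                    ≡⟨ *-comm (W b) ∣ J ∣ ⟩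
    ∣ J ∣ * W b                    ≡⟨ sym (sum-ind-* J (W b)) ⟩
    sum (λ i → ind (i ∈? J) * W b) ≤⟨ sum-mono bound ⟩
    sum (u ⊤)                      ≤⟨ total n ⊤ (∣⊤∣≡n n) ⟩
    N !                            ≡⟨ sym (W*C b a+b≤N) ⟩
    W b * ((a + b) C a) ∎)
    where
    open ≤-Reasoning
    a+b≤N : a + b ≤ N
    a+b≤N = m≤n+m (a + b) n
    W≢0 : NonZero (W b)
    W≢0 = m*n≢0⇒m≢0 (W b) {{subst NonZero (sym (W*C b a+b≤N)) (N !≢0)}}
    bound : ∀ i → ind (i ∈? J) * W b ≤ u ⊤ i
    bound i with i ∈? J
    ... | no _ = z≤n
    ... | yes i∈J = begin
      1 * W b         ≡⟨ *-identityˡ (W b) ⟩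
      W b             ≤⟨ W-antitone (≤-trans (∣p∩q∣≤∣p∣ (B i) ⊤) (∣B∣≤b i i∈J)) a+b≤N ⟩
      W ∣ B i ∩ ⊤ ∣   ≡⟨ sym (*-identityˡ _) ⟩
      1 * W ∣ B i ∩ ⊤ ∣ ≡⟨ cong (_* W ∣ B i ∩ ⊤ ∣) (sym (ind-yes (yes i∈J ×-dec (A i ⊆? ⊤)) (i∈J , λ _ → ∈⊤))) ⟩
      ind (yes i∈J ×-dec (A i ⊆? ⊤)) * W ∣ B i ∩ ⊤ ∣ ∎

-- Union sizes and choice over finite sets.

∣p∪q∣≤∣p∣+∣q∣ : ∀ (p q : Subset n) → ∣ p ∪ q ∣ ≤ ∣ p ∣ + ∣ q ∣
∣p∪q∣≤∣p∣+∣q∣ [] [] = z≤n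
∣p∪q∣≤∣p∣+∣q∣ (outside ∷ p) (outside ∷ q) = ∣p∪q∣≤∣p∣+∣q∣ p q
∣p∪q∣≤∣p∣+∣q∣ (outside ∷ p) (inside ∷ q) =
  ≤-trans (s≤s (∣p∪q∣≤∣p∣+∣q∣ p q)) (≤-reflexive (sym (+-suc ∣ p ∣ ∣ q ∣)))
∣p∪q∣≤∣p∣+∣q∣ (inside ∷ p) (outside ∷ q) = s≤s (∣p∪q∣≤∣p∣+∣q∣ p q)
∣p∪q∣≤∣p∣+∣q∣ (inside ∷ p) (inside ∷ q) =
  s≤s (≤-trans (∣p∪q∣≤∣p∣+∣q∣ p q) (+-monoʳ-≤ ∣ p ∣ (n≤1+n ∣ q ∣)))

p⊈q⇒∃ : ∀ (p q : Subset n) → ¬ p ⊆ q → ∃ λ x → x ∈ p × x ∉ q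
p⊈q⇒∃ p q h with Fin.any? (λ x → (x ∈? p) ×-dec ¬? (x ∈? q))
... | yes w = w
... | no ¬w = ⊥-elim (h sub)
  where
  sub : p ⊆ q
  sub {x} x∈p with x ∈? q
  ... | yes x∈q = x∈q
  ... | no x∉q = contradiction (x , x∈p , x∉q) ¬w

-- `Y` is the image of a choice function on `Z`, built by recursion so that `R` may be undecidable.
-- The last clause lets `shrink` keep `Y` off a given block.
image-choice : ∀ (Z : Subset m) (R : Fin m → Fin n → Set) → (∀ x → x ∈ Z → ∃ (R x)) →
  ∃ λ Y → ∣ Y ∣ ≤ ∣ Z ∣ × (∀ x → x ∈ Z → ∃ λ y → y ∈ Y × R x y)
                        × (∀ y → y ∈ Y → ∃ λ x → x ∈ Z × R x y)
image-choice {n = n} [] R h = ⊥ , ≤-reflexive (∣⊥∣≡0 n) , (λ ()) , λ y y∈ → contradiction y∈ ∉⊥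
image-choice (outside ∷ Z) R h =
  let (Y , le , to , from) = image-choice Z (R ∘ suc) (λ x x∈ → h (suc x) (there x∈)) in
  Y , le , (λ { (suc x) (there x∈) → to x x∈ }) ,
  λ y y∈ → let (x , x∈ , r) = from y y∈ in suc x , there x∈ , r
image-choice (inside ∷ Z) R h =
  let (Y , le , to , from) = image-choice Z (R ∘ suc) (λ x x∈ → h (suc x) (there x∈))
      (y₀ , r₀) = h zero here
  in
  ⁅ y₀ ⁆ ∪ Y ,
  ≤-trans (∣p∪q∣≤∣p∣+∣q∣ ⁅ y₀ ⁆ Y) (≤-trans (≤-reflexive (cong (_+ ∣ Y ∣) (∣⁅x⁆∣≡1 y₀))) (s≤s le)) ,
  (λ { zero here → y₀ , x∈p∪q⁺ (inj₁ (x∈⁅x⁆ y₀)) , r₀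
     ; (suc x) (there x∈) → let (y , y∈ , r) = to x x∈ in y , x∈p∪q⁺ {p = ⁅ y₀ ⁆} (inj₂ y∈) , r }) ,
  λ y y∈ → split y₀ r₀ Y from y (x∈p∪q⁻ ⁅ y₀ ⁆ Y y∈)
  where
  split : ∀ y₀ → R zero y₀ → ∀ Y → (∀ y → y ∈ Y → ∃ λ x → x ∈ Z × R (suc x) y) →
          ∀ y → y ∈ ⁅ y₀ ⁆ ⊎ y ∈ Y → ∃ λ x → x ∈ inside ∷ Z × R x y
  split y₀ r₀ Y from y (inj₁ h) with x∈⁅y⁆⇒x≡y y₀ h
  ... | refl = zero , here , r₀
  split y₀ r₀ Y from y (inj₂ h) = let (x , x∈ , r) = from y h in suc x , there x∈ , r

choice-on : ∀ {Y : Set} (y₀ : Y) (J : Subset m) (R : Fin m → Y → Set) → (∀ j → j ∈ J → ∃ (R j)) →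
  ∃ λ f → ∀ j → j ∈ J → R j (f j)
choice-on {m = m} {Y} y₀ J R h = f , spec
  where
  f : Fin m → Y
  f j with j ∈? J
  ... | yes j∈J = proj₁ (h j j∈J)
  ... | no _ = y₀
  spec : ∀ j → j ∈ J → R j (f j)
  spec j j∈J with j ∈? J
  ... | yes j∈J′ = proj₂ (h j j∈J′)
  ... | no j∉J = contradiction j∈J j∉J

-- Covers, private points and truncated blocks.

Covered : Subset m → (Fin m → Subset n) → Fin n → Set
Covered J S x = ∃ λ j → j ∈ J × x ∈ S j

covered? : ∀ (J : Subset m) (S : Fin m → Subset n) x → Dec (Covered J S x)
covered? J S x = Fin.any? (λ j → (j ∈? J) ×-dec (x ∈? S j))

union : Subset m → (Fin m → Subset n) → Subset n
union J S = filter (covered? J S)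

∈union⁺ : ∀ {J : Subset m} {S : Fin m → Subset n} {x} → Covered J S x → x ∈ union J S
∈union⁺ {J = J} {S} = ∈filter⁺ (covered? J S)

∈union⁻ : ∀ {J : Subset m} {S : Fin m → Subset n} {x} → x ∈ union J S → Covered J S x
∈union⁻ {J = J} {S} = ∈filter⁻ (covered? J S)

Private : Subset m → (Fin m → Subset n) → Fin m → Fin n → Set
Private J S j p = p ∈ S j × (∀ k → k ∈ J → p ∈ S k → k ≡ j)

Irredundant : Subset m → (Fin m → Subset n) → Set
Irredundant J S = ∀ j → j ∈ J → ∃ (Private J S j)

-- Blocks lying in the union of the others are discarded one at a time. Once none is left, each
-- block has a point outside all the others.
irredundant-subfamily : ∀ (S : Fin m → Subset n) (J : Subset m) →
  ∃ λ J′ → J′ ⊆ J × (∀ {x} → Covered J S x → Covered J′ S x) × Irredundant J′ S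
irredundant-subfamily {m} {n} S J = go (suc ∣ J ∣) J ≤-refl
  where
  go : ∀ c J → ∣ J ∣ < c → ∃ λ J′ → J′ ⊆ J × (∀ {x} → Covered J S x → Covered J′ S x) × Irredundant J′ S
  go (suc c) J (s≤s le) with Fin.any? (λ j → (j ∈? J) ×-dec (S j ⊆? union (J - j) S))
  ... | yes (j , j∈J , sub) =
    let (J′ , J′⊆ , cov , irr) = go c (J - j) (≤-trans (x∈p⇒∣p-x∣<∣p∣ j∈J) le) in
    J′ , (λ h → x∈p-y⇒x∈p J (J′⊆ h)) , (λ h → cov (still h)) , irr
    where
    still : ∀ {x} → Covered J S x → Covered (J - j) S x
    still (k , k∈J , x∈) with k Fin.≟ j
    ... | yes refl = ∈union⁻ (sub x∈)
    ... | no k≢j = k , x∈p∧x≢y⇒x∈p-y k∈J k≢j , x∈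
  ... | no h = J , (λ x → x) , (λ x → x) , λ j j∈J →
    let (p , p∈ , p∉) = p⊈q⇒∃ (S j) _ (λ sub → h (j , j∈J , sub)) in
    p , p∈ , λ k k∈J p∈k → only j p p∉ k k∈J p∈k
    where
    only : ∀ j p → p ∉ union (J - j) S → ∀ k → k ∈ J → p ∈ S k → k ≡ j
    only j p p∉ k k∈J p∈k with k Fin.≟ j
    ... | yes e = e
    ... | no k≢j = contradiction (∈union⁺ (k , x∈p∧x≢y⇒x∈p-y k∈J k≢j , p∈k)) p∉

-- The trace of `S` that survives exchanges: by symmetry in `c` and `d`, multiply covered points of
-- `T` keep their memberships in `S`.
Link : Subset m → (S T : Fin m → Subset n) → Set
Link J S T = ∀ {c d x} → c ∈ J → d ∈ J → c ≢ d → x ∈ T c → x ∈ T d → x ∈ S c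

module _ {a : ℕ} {J : Subset m} {S D : Fin m → Subset n}
         (∣S∣≡1+a : ∀ j → j ∈ J → ∣ S j ∣ ≡ suc a)
         (trunc : ∀ j → j ∈ J → ∃ λ p → Private J S j p × D j ≡ S j - p)
         (distinct : ∀ i j → i ∈ J → j ∈ J → D i ≡ D j → i ≡ j) where

  D⊆S : ∀ {j} → j ∈ J → D j ⊆ S j
  D⊆S {j} j∈J h = let (p , _ , e) = trunc j j∈J in x∈p-y⇒x∈p (S j) (subst (_ ∈_) e h)

  ∣D∣≡a : ∀ j → j ∈ J → ∣ D j ∣ ≡ a
  ∣D∣≡a j j∈J = let (p , (p∈ , _) , e) = trunc j j∈J in
    suc-injective (trans (cong (suc ∘ ∣_∣) e) (trans (x∈p⇒suc∣p-x∣≡∣p∣ (S j) p∈) (∣S∣≡1+a j j∈J)))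

  -- The point removed from `S i` is private, hence not in `D j`. An inclusion in `S i` would thus
  -- be one in `D i`, and equal sizes would make the two truncations coincide.
  D⊈S : ∀ {i j} → i ∈ J → j ∈ J → j ≢ i → ¬ D j ⊆ S i
  D⊈S {i} {j} i∈J j∈J j≢i sub = j≢i (distinct j i j∈J i∈J (⊆-antisym Dj⊆Di
      (p⊆q∧∣q∣≤∣p∣⇒q⊆p (D j) (D i) Dj⊆Di (≤-reflexive (trans (∣D∣≡a i i∈J) (sym (∣D∣≡a j j∈J)))))))
    where
    Dj⊆Di : D j ⊆ D i
    Dj⊆Di h = let (p , (p∈ , only) , e) = trunc i i∈J in
      subst (_ ∈_) (sym e) (x∈p∧x≢y⇒x∈p-y (sub h) λ { refl → j≢i (only j j∈J (D⊆S j∈J h)) })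

  -- Points of Z lying in two blocks of T lie in the same blocks of S and avoid
  -- the removed private points; a point lying in the single block T j may be
  -- replaced by any point of D j outside S i.
  shrink : ∀ {T} → Link J S T → ∀ {i} → i ∈ J → T i ≡ S i → (Z : Subset n) →
    (∀ x → x ∈ S i → x ∉ Z) → (∀ j → j ∈ J → j ≢ i → ∃ λ x → x ∈ T j × x ∈ Z) →
    ∃ λ Y → ∣ Y ∣ ≤ ∣ Z ∣ × (∀ x → x ∈ D i → x ∉ Y) × (∀ j → j ∈ J → j ≢ i → ∃ λ x → x ∈ D j × x ∈ Y)
  shrink {T} link {i} i∈J Ti≡Si Z miss hit =
    let (Y , le , to , from) = image-choice Z R total in
    Y , le ,
    (λ y y∈D y∈Y → let (_ , _ , y∉S , _) = from y y∈Y in y∉S (D⊆S i∈J y∈D)) ,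
    λ j j∈J j≢i → let (x , x∈T , x∈Z) = hit j j∈J j≢i
                      (y , y∈Y , _ , into) = to x x∈Z
                  in y , into j j∈J x∈T , y∈Y
    where
    R : Fin n → Fin n → Set
    R x y = y ∉ S i × (∀ j → j ∈ J → x ∈ T j → y ∈ D j)

    multiple : ∀ {x} → x ∈ Z → ∀ {j k} → j ∈ J → k ∈ J → k ≢ j → x ∈ T j → x ∈ T k → x ∈ D j
    multiple {x} x∈Z {j} {k} j∈J k∈J k≢j x∈Tj x∈Tk = let (p , (p∈ , only) , e) = trunc j j∈J in
      subst (x ∈_) (sym e) (x∈p∧x≢y⇒x∈p-y (link j∈J k∈J (k≢j ∘ sym) x∈Tj x∈Tk)
        λ { refl → k≢j (only k k∈J (link k∈J j∈J k≢j x∈Tk x∈Tj)) })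

    total : ∀ x → x ∈ Z → ∃ (R x)
    total x x∈Z with covered? J T x
    ... | no h = x , (λ x∈S → miss x x∈S x∈Z) , λ j j∈J x∈T → contradiction (j , j∈J , x∈T) h
    ... | yes (j , j∈J , x∈Tj) with Fin.any? (λ k → (k ∈? J) ×-dec ((x ∈? T k) ×-dec ¬? (k Fin.≟ j)))
    ... | yes (k , k∈J , x∈Tk , k≢j) = x , (λ x∈S → miss x x∈S x∈Z) , into
      where
      into : ∀ l → l ∈ J → x ∈ T l → x ∈ D l
      into l l∈J x∈Tl with l Fin.≟ j
      ... | yes refl = multiple x∈Z l∈J k∈J k≢j x∈Tl x∈Tk
      ... | no l≢j = multiple x∈Z l∈J j∈J (l≢j ∘ sym) x∈Tl x∈Tj
    ... | no unique =
      let (y , y∈D , y∉S) = p⊈q⇒∃ (D j) (S i) (D⊈S i∈J j∈J j≢i) in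
      y , y∉S , λ l l∈J x∈Tl → subst (λ l → y ∈ D l) (sym (same l l∈J x∈Tl)) y∈D
      where
      j≢i : j ≢ i
      j≢i refl = miss x (subst (x ∈_) Ti≡Si x∈Tj) x∈Z
      same : ∀ l → l ∈ J → x ∈ T l → l ≡ j
      same l l∈J x∈Tl with l Fin.≟ j
      ... | yes e = e
      ... | no l≢j = contradiction (l , l∈J , x∈Tl , l≢j) unique

-- The union of an intersecting set-pair system.

irredundant⇒distinct : ∀ {J : Subset m} {S : Fin m → Subset n} → Irredundant J S →
  ∀ i j → i ∈ J → j ∈ J → S i ≡ S j → i ≡ j
irredundant⇒distinct irr i j i∈J j∈J e =
  let (p , p∈ , only) = irr j j∈J in only i i∈J (subst (p ∈_) (sym e) p∈)

∣union∣≤∣J∣+∣union∣ : ∀ (J : Subset m) (S D : Fin m → Subset n) →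
  (∀ j → j ∈ J → ∃ λ p → D j ≡ S j - p) → ∣ union J S ∣ ≤ ∣ J ∣ + ∣ union J D ∣
∣union∣≤∣J∣+∣union∣ J S D trunc =
  let (P , le , to , _) = image-choice J (λ j p → D j ≡ S j - p) trunc in
  ≤-trans (p⊆q⇒∣p∣≤∣q∣ (λ {x} x∈ →
      let (j , j∈J , x∈S) = ∈union⁻ x∈
          (p , p∈P , e) = to j j∈J
      in x∈p∪q⁺ (split P j j∈J p p∈P e x x∈S)))
    (≤-trans (∣p∪q∣≤∣p∣+∣q∣ P (union J D)) (+-monoˡ-≤ _ le))
  where
  split : ∀ P j → j ∈ J → ∀ p → p ∈ P → D j ≡ S j - p → ∀ x → x ∈ S j → x ∈ P ⊎ x ∈ union J D
  split P j j∈J p p∈P e x x∈S with x Fin.≟ p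
  ... | yes refl = inj₁ p∈P
  ... | no x≢p = inj₂ (∈union⁺ (j , j∈J , subst (x ∈_) (sym e) (x∈p∧x≢y⇒x∈p-y x∈S x≢p)))

-- Induction on `a`: an irredundant subfamily has the same union, `bollobás` bounds its length, and
-- removing one private point per block leaves a system of type `(a, b)`. Pascal's rule adds the two
-- bounds; strictness comes from the empty union at `a = 0`.
∣union∣<C : ∀ a b {J : Subset m} {A B : Fin m → Subset n} →
  (∀ i → i ∈ J → ∣ A i ∣ ≡ a) → (∀ i → i ∈ J → ∣ B i ∣ ≤ b) → IntersectingPairs J A B →
  ∣ union J A ∣ < suc (a + b) C a
∣union∣<C {n = n} zero b {J} {A} ∣A∣ ∣B∣ pairs = ≤-reflexive (cong suc (trans
  (cong ∣_∣ (Empty-unique {p = union J A} λ (x , x∈) →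
    let (j , j∈J , x∈A) = ∈union⁻ x∈ in ∣p∣≡0⇒x∉p (A j) (∣A∣ j j∈J) x∈A)) (∣⊥∣≡0 n)))
∣union∣<C {n = n} (suc a) b {J} {A} {B} ∣A∣ ∣B∣ (disjoint , cross) =
  let (J₁ , J₁⊆J , cov₁ , irr₁) = irredundant-subfamily A J
      (D , trunc₁) = choice-on ⊥ J₁ (λ j D → ∃ λ p → Private J₁ A j p × D ≡ A j - p)
                       (λ j j∈ → let (p , priv) = irr₁ j j∈ in A j - p , p , priv , refl)
      -- The truncations may coincide; a second thinning makes them distinct, as `shrink` requires,
      -- without changing their union.
      (J₂ , J₂⊆J₁ , cov₂ , irr₂) = irredundant-subfamily D J₁
      trunc₂ : ∀ j → j ∈ J₂ → ∃ λ p → Private J₂ A j p × D j ≡ A j - p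
      trunc₂ j j∈ = let (p , (p∈ , only) , e) = trunc₁ j (J₂⊆J₁ j∈) in
        p , (p∈ , λ k k∈ → only k (J₂⊆J₁ k∈)) , e
      in-J : ∀ {j} → j ∈ J₂ → j ∈ J
      in-J j∈ = J₁⊆J (J₂⊆J₁ j∈)
      size : ∀ j → j ∈ J₂ → ∣ A j ∣ ≡ suc a
      size j j∈ = ∣A∣ j (in-J j∈)
      distinct = irredundant⇒distinct irr₂
      (B′ , spec) = choice-on ⊥ J₂ (λ i Y → ∣ Y ∣ ≤ ∣ B i ∣ × (∀ x → x ∈ D i → x ∉ Y) ×
                        (∀ j → j ∈ J₂ → j ≢ i → ∃ λ x → x ∈ D j × x ∈ Y))
                      (λ i i∈ → shrink size trunc₂ distinct {T = A} (λ _ _ _ x∈ _ → x∈) i∈ refl (B i)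
                         (disjoint i (in-J i∈)) (λ j j∈ j≢i → cross j i (in-J j∈) (in-J i∈) j≢i))
  in
  begin-strict
    ∣ union J A ∣    ≤⟨ p⊆q⇒∣p∣≤∣q∣ (λ x∈ → ∈union⁺ (cov₁ (∈union⁻ x∈))) ⟩
    ∣ union J₁ A ∣   ≤⟨ ∣union∣≤∣J∣+∣union∣ J₁ A D (λ j j∈ → let (p , _ , e) = trunc₁ j j∈ in p , e) ⟩
    ∣ J₁ ∣ + ∣ union J₁ D ∣
      ≤⟨ +-mono-≤ (bollobás (λ i i∈ → ∣A∣ i (J₁⊆J i∈)) (λ i i∈ → ∣B∣ i (J₁⊆J i∈))
                     ((λ i i∈ → disjoint i (J₁⊆J i∈)) , λ i j i∈ j∈ → cross i j (J₁⊆J i∈) (J₁⊆J j∈)))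
                  (p⊆q⇒∣p∣≤∣q∣ (λ x∈ → ∈union⁺ (cov₂ (∈union⁻ x∈)))) ⟩
    ((suc a + b) C suc a) + ∣ union J₂ D ∣
      <⟨ +-monoʳ-< ((suc a + b) C suc a)
           (∣union∣<C a b (∣D∣≡a size trunc₂ distinct)
              (λ i i∈ → ≤-trans (proj₁ (spec i i∈)) (∣B∣ i (in-J i∈)))
              ((λ i i∈ → proj₁ (proj₂ (spec i i∈))) , λ i j i∈ j∈ i≢j → proj₂ (proj₂ (spec j j∈)) i i∈ i≢j)) ⟩
    ((suc a + b) C suc a) + ((suc a + b) C a)   ≡⟨ +-comm ((suc a + b) C suc a) _ ⟩
    ((suc a + b) C a) + ((suc a + b) C suc a)   ≡⟨ nCk+nC[k+1]≡[n+1]C[k+1] (suc a + b) a ⟩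
    suc (suc a + b) C suc a ∎
  where open ≤-Reasoning

-- Growth of binomial coefficients.

0<nCk : ∀ {n k} → k ≤ n → 0 < n C k
0<nCk {n} {zero} z≤n = s≤s z≤n
0<nCk {suc n} {suc k} (s≤s k≤n) = subst (0 <_) (nCk+nC[k+1]≡[n+1]C[k+1] n k) (≤-trans (0<nCk k≤n) (m≤m+n _ _))

C-step : ∀ n k → n C k ≤ suc n C k
C-step n zero = ≤-refl
C-step n (suc k) = subst (n C suc k ≤_) (nCk+nC[k+1]≡[n+1]C[k+1] n k) (m≤n+m _ _)

C-grow : ∀ d n k → n C k ≤ (d + n) C k
C-grow zero n k = ≤-refl
C-grow (suc d) n k = ≤-trans (C-grow d n k) (C-step (d + n) k)

-- Each step of Pascal's rule adds a positive binomial. This later absorbs the uncovered vertices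
-- into the bound.
+C≤C : ∀ d {n k} → k ≤ n → d + n C suc k ≤ (d + n) C suc k
+C≤C zero k≤n = ≤-refl
+C≤C (suc d) {n} {k} k≤n = begin
  1 + (d + n C suc k)                     ≤⟨ +-mono-≤ (0<nCk (≤-trans k≤n (m≤n+m n d))) (+C≤C d k≤n) ⟩
  (d + n) C k + (d + n) C suc k           ≡⟨ nCk+nC[k+1]≡[n+1]C[k+1] (d + n) k ⟩
  (suc d + n) C suc k ∎
  where open ≤-Reasoning

-- Finite decidability arguments and splitting of subsets.

_≟ˢ_ : (p q : Subset n) → Dec (p ≡ q)
_≟ˢ_ = ≡-dec Bool._≟_

-- Double negation shift over a finite domain: while proving a negation, finitely many instances of
-- excluded middle may be assumed together.
¬¬-∀-Fin : {P : Fin n → Set} → (∀ i → ¬ ¬ P i) → ¬ ¬ (∀ i → P i)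
¬¬-∀-Fin {zero} h κ = κ λ ()
¬¬-∀-Fin {suc n} h κ = h zero λ p → ¬¬-∀-Fin (h ∘ suc) λ ps → κ λ { zero → p ; (suc i) → ps i }

¬¬-∀-Subset : {P : Subset n → Set} → (∀ p → ¬ ¬ P p) → ¬ ¬ (∀ p → P p)
¬¬-∀-Subset {zero} h κ = h [] λ x → κ λ { [] → x }
¬¬-∀-Subset {suc n} h κ =
  ¬¬-∀-Subset (λ p → h (outside ∷ p)) λ f → ¬¬-∀-Subset (λ p → h (inside ∷ p)) λ g →
  κ λ { (outside ∷ p) → f p ; (inside ∷ p) → g p }

¬¬-Dec : {P : Set} → ¬ ¬ Dec P
¬¬-Dec κ = κ (no λ p → κ (yes p))

∣p∩q∣+∣p∩∁q∣≡∣p∣ : ∀ (p q : Subset n) → ∣ p ∩ q ∣ + ∣ p ∩ ∁ q ∣ ≡ ∣ p ∣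
∣p∩q∣+∣p∩∁q∣≡∣p∣ [] [] = refl
∣p∩q∣+∣p∩∁q∣≡∣p∣ (outside ∷ p) (_ ∷ q) = ∣p∩q∣+∣p∩∁q∣≡∣p∣ p q
∣p∩q∣+∣p∩∁q∣≡∣p∣ (inside ∷ p) (inside ∷ q) = cong suc (∣p∩q∣+∣p∩∁q∣≡∣p∣ p q)
∣p∩q∣+∣p∩∁q∣≡∣p∣ (inside ∷ p) (outside ∷ q) = trans (+-suc ∣ p ∩ q ∣ _) (cong suc (∣p∩q∣+∣p∩∁q∣≡∣p∣ p q))

-- Extending a family and replacing a block.

extend : Subset n → (Fin m → Subset n) → Fin (suc m) → Subset n
extend F S zero = F
extend F S (suc j) = S j

replace : (Fin m → Subset n) → Fin m → Subset n → Fin m → Subset n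
replace S j F c with c Fin.≟ j
... | yes _ = F
... | no _ = S c

replace-view : ∀ (S : Fin m → Subset n) j F c →
  (c ≡ j × replace S j F c ≡ F) ⊎ (c ≢ j × replace S j F c ≡ S c)
replace-view S j F c with c Fin.≟ j
... | yes e = inj₁ (e , refl)
... | no ne = inj₂ (ne , refl)

replace-same : ∀ (S : Fin m → Subset n) j F → replace S j F j ≡ F
replace-same S j F with replace-view S j F j
... | inj₁ (_ , e) = e
... | inj₂ (ne , _) = contradiction refl ne

Link-trans : ∀ {J : Subset m} {S T U : Fin m → Subset n} → Link J S T → Link J T U → Link J S U
Link-trans st tu c∈J d∈J c≢d x∈c x∈d =
  st c∈J d∈J c≢d (tu c∈J d∈J c≢d x∈c x∈d) (tu d∈J c∈J (c≢d ∘ sym) x∈d x∈c)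

Meets : Subset n → Subset n → Set
Meets p q = ∃ λ x → x ∈ p × x ∈ q

-- Critical hypergraphs and maximum families.

record CriticalTransversal {n} (a b : ℕ) (G : Subset n → Set) : Set where
  field
    size      : ∀ {F} → G F → ∣ F ∣ ≡ suc a
    no-transversal : ∀ X → ∣ X ∣ ≤ b → ¬ (∀ F → G F → Meets F X)
    critical  : ∀ {F} → G F → ∃ λ X → ∣ X ∣ ≤ b × (∀ x → x ∈ F → x ∉ X) ×
                  (∀ F′ → G F′ → F′ ≢ F → Meets F′ X)
    spanning  : ∀ v → ∃ λ F → G F × v ∈ F

module _ {n a b : ℕ} {G : Subset n → Set} (crit : CriticalTransversal a b G) where

  open CriticalTransversal crit

  -- `distinct` ranges over all removed points, not just private ones, so truncations differ for
  -- every choice of private points and the condition survives exchanges.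
  record Good {m} (J : Subset m) (S : Fin m → Subset n) : Set where
    field
      edges       : ∀ j → j ∈ J → G (S j)
      irredundant : Irredundant J S
      distinct    : ∀ i j → i ∈ J → j ∈ J → ∀ p q → p ∈ S i → q ∈ S j → S i - p ≡ S j - q → i ≡ j

  Maximum : Subset m → (Fin m → Subset n) → Set
  Maximum J S = ∀ {m′} (J′ : Subset m′) S′ → Good J′ S′ → ∣ union J′ S′ ∣ ≤ ∣ union J S ∣

  -- A family refuting maximality has a larger union, so the search restarts from it; `d` bounds the
  -- room left below `n`.
  ¬¬-maximum : ¬ ¬ (∃ λ m → ∃₂ λ (J : Subset m) S → Good J S × Maximum J S)
  ¬¬-maximum = go n {J = []} {S = λ ()} empty (m≤m+n n _)
    where
    empty : Good [] (λ ())
    empty = record { edges = λ () ; irredundant = λ () ; distinct = λ () }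
    go : ∀ d {m} {J : Subset m} {S} → Good J S → n ≤ d + ∣ union J S ∣ →
         ¬ ¬ (∃ λ m → ∃₂ λ (J : Subset m) S → Good J S × Maximum J S)
    go zero good le κ = κ (_ , _ , _ , good , λ J′ S′ _ → ≤-trans (∣p∣≤n (union J′ S′)) le)
    go (suc d) {J = J} {S} good le κ = κ (_ , _ , _ , good , bound)
      where
      bound : Maximum J S
      bound J′ S′ good′ with ∣ union J′ S′ ∣ ≤? ∣ union J S ∣
      ... | yes p = p
      ... | no ≰ = ⊥-elim (go d good′
            (≤-trans le (≤-trans (≤-reflexive (sym (+-suc d _))) (+-monoʳ-≤ d (≰⇒> ≰)))) κ)

  module _ {m} {J : Subset m} {S : Fin m → Subset n} (good : Good J S) where

    open Good good

    private
      -- Adding `F` to the blocks of `K` and thinning would give a good family that covers all of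
      -- the old union and `v` too.
      no-extension : Maximum J S → ∀ {v F} → ¬ Covered J S v → G F → v ∈ F →
        ∀ K → K ⊆ J → (∀ {x} → Covered J S x → x ∈ F ⊎ Covered K S x) →
        (∀ j → j ∈ K → ∀ q → q ∈ S j → S j - q ≢ F - v) → Empty.⊥
      no-extension max {v} {F} hole GF v∈F K K⊆J cover separate =
        let (L , L⊆ , cov , irr) = irredundant-subfamily (extend F S) (inside ∷ K)
            v-covered : Covered L (extend F S) v
            v-covered = cov (zero , here , v∈F)
            all : ∀ {x} → Covered J S x → Covered L (extend F S) x
            all h = cov (lift (cover h))
            in-J : ∀ {j} → suc j ∈ L → j ∈ J
            in-J h = K⊆J (drop-there (L⊆ h))
            clash : ∀ j → suc j ∈ L → ∀ p q → p ∈ F → q ∈ S j → F - p ≡ S j - q → Empty.⊥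
            clash j j∈ p q p∈F q∈ e = collide j (drop-there (L⊆ j∈)) p q q∈ e
            good′ : Good L (extend F S)
            good′ = record
              { edges = λ { zero _ → GF ; (suc j) j∈ → edges j (in-J j∈) }
              ; irredundant = irr
              ; distinct = λ
                { zero zero _ _ _ _ _ _ _ → refl
                ; zero (suc j) _ j∈ p q p∈ q∈ e → ⊥-elim (clash j j∈ p q p∈ q∈ e)
                ; (suc i) zero i∈ _ p q p∈ q∈ e → ⊥-elim (clash i i∈ q p q∈ p∈ (sym e))
                ; (suc i) (suc j) i∈ j∈ p q p∈ q∈ e → cong suc (distinct i j (in-J i∈) (in-J j∈) p q p∈ q∈ e) }
              }
        in <⇒≱ (p⊂q⇒∣p∣<∣q∣ ((λ h → ∈union⁺ (all (∈union⁻ h))) , v , ∈union⁺ v-covered , hole ∘ ∈union⁻))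
               (max L (extend F S) good′)
        where
        lift : ∀ {x} → x ∈ F ⊎ Covered K S x → Covered (inside ∷ K) (extend F S) x
        lift (inj₁ x∈F) = zero , here , x∈F
        lift (inj₂ (j , j∈K , x∈S)) = suc j , there j∈K , x∈S
        collide : ∀ j → j ∈ K → ∀ p q → q ∈ S j → F - p ≡ S j - q → Empty.⊥
        collide j j∈K p q q∈ e with v Fin.≟ p
        ... | yes refl = separate j j∈K q q∈ (sym e)
        -- A coincidence that keeps `v` in the truncation of `F` would put `v` into a block.
        ... | no v≢p = hole (j , K⊆J j∈K , x∈p-y⇒x∈p (S j) (subst (v ∈_) e (x∈p∧x≢y⇒x∈p-y v∈F v≢p)))

    -- If no block matches `F` up to trading one point for `v`, then `F` can be added outright. If
    -- the traded point `p` lay in a second block, `F` could replace `S j` without uncovering `p`.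
    -- Both contradict maximality.
    exchange : Maximum J S → ∀ {v F} → ¬ Covered J S v → G F → v ∈ F →
      ∃ λ j → j ∈ J × ∃ λ p → Private J S j p × S j - p ≡ F - v
    exchange max {v} {F} hole GF v∈F with
      Fin.any? (λ j → (j ∈? J) ×-dec Fin.any? (λ p → (p ∈? S j) ×-dec ((S j - p) ≟ˢ (F - v))))
    ... | no none = ⊥-elim (no-extension max hole GF v∈F J (λ h → h) inj₂
            λ j j∈J q q∈ e → none (j , j∈J , q , q∈ , e))
    ... | yes (j , j∈J , p , p∈ , e) with
      Fin.any? (λ k → (k ∈? J) ×-dec ((p ∈? S k) ×-dec ¬? (k Fin.≟ j)))
    ... | no none = j , j∈J , p , (p∈ , only) , e
      where
      only : ∀ k → k ∈ J → p ∈ S k → k ≡ j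
      only k k∈J p∈k with k Fin.≟ j
      ... | yes k≡j = k≡j
      ... | no k≢j = contradiction (k , k∈J , p∈k , k≢j) none
    ... | yes (k , k∈J , p∈k , k≢j) = ⊥-elim (no-extension max hole GF v∈F (J - j) (x∈p-y⇒x∈p J) cover
            λ l l∈ q q∈ e′ → x∈p-y⇒x≢y J l∈ (distinct l j (x∈p-y⇒x∈p J l∈) j∈J q p q∈ p∈ (trans e′ (sym e))))
      where
      cover : ∀ {x} → Covered J S x → x ∈ F ⊎ Covered (J - j) S x
      cover {x} (l , l∈J , x∈l) with l Fin.≟ j | x Fin.≟ p
      ... | no l≢j | _ = inj₂ (l , x∈p∧x≢y⇒x∈p-y l∈J l≢j , x∈l)
      ... | yes refl | yes refl = inj₂ (k , x∈p∧x≢y⇒x∈p-y k∈J k≢j , p∈k)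
      ... | yes refl | no x≢p = inj₁ (x∈p-y⇒x∈p F (subst (x ∈_) e (x∈p∧x≢y⇒x∈p-y x∈l x≢p)))

    -- The effect of one exchange.

    module Move {u F} (hole : ¬ Covered J S u) (GF : G F) (u∈F : u ∈ F)
                {j p} (j∈J : j ∈ J) (priv : Private J S j p) (swap : S j - p ≡ F - u) where

      S′ : Fin m → Subset n
      S′ = replace S j F

      F⇒S : ∀ {x} → x ∈ F → x ≢ u → x ∈ S j - p
      F⇒S x∈F x≢u = subst (_ ∈_) (sym swap) (x∈p∧x≢y⇒x∈p-y x∈F x≢u)

      S⇒F : ∀ {x} → x ∈ S j → x ≢ p → x ∈ F
      S⇒F x∈S x≢p = x∈p-y⇒x∈p F (subst (_ ∈_) swap (x∈p∧x≢y⇒x∈p-y x∈S x≢p))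

      covered-before : ∀ {x} → Covered J S′ x → Covered J S x ⊎ x ≡ u
      covered-before {x} (c , c∈J , x∈c) with replace-view S j F c
      ... | inj₂ (_ , e) = inj₁ (c , c∈J , subst (x ∈_) e x∈c)
      ... | inj₁ (_ , e) with x Fin.≟ u
      ... | yes x≡u = inj₂ x≡u
      ... | no x≢u = inj₁ (j , j∈J , x∈p-y⇒x∈p (S j) (F⇒S (subst (x ∈_) e x∈c) x≢u))

      new-hole : ¬ Covered J S′ p
      new-hole (c , c∈J , p∈c) with replace-view S j F c
      ... | inj₂ (c≢j , e) = c≢j (proj₂ priv c c∈J (subst (p ∈_) e p∈c))
      ... | inj₁ (_ , e) = x∉p-x (S j) p (F⇒S (subst (p ∈_) e p∈c) λ { refl → hole (j , j∈J , proj₁ priv) })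

      -- Only `u` is new in block `j`, and a hole lies in no other block. `linkFrom` is dual: only
      -- `p` is lost, and it was private.
      linkTo : Link J S S′
      linkTo {c} {d} {x} c∈J d∈J c≢d x∈c x∈d with replace-view S j F c | replace-view S j F d
      ... | inj₂ (_ , e) | _ = subst (x ∈_) e x∈c
      ... | inj₁ (refl , _) | inj₁ (refl , _) = contradiction refl c≢d
      ... | inj₁ (refl , e) | inj₂ (_ , e′) = x∈p-y⇒x∈p (S j) (F⇒S (subst (x ∈_) e x∈c)
              λ { refl → hole (d , d∈J , subst (x ∈_) e′ x∈d) })

      linkFrom : Link J S′ S
      linkFrom {c} {d} {x} c∈J d∈J c≢d x∈c x∈d with replace-view S j F c
      ... | inj₂ (_ , e) = subst (x ∈_) (sym e) x∈c
      ... | inj₁ (refl , e) = subst (x ∈_) (sym e) (S⇒F x∈c λ { refl → c≢d (sym (proj₂ priv d d∈J x∈d)) })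

      ∣union∣≤ : ∣ union J S ∣ ≤ ∣ union J S′ ∣
      ∣union∣≤ = subst₂ _≤_
        (x∈p⇒suc∣p-x∣≡∣p∣ (union J S) (∈union⁺ (j , j∈J , proj₁ priv)))
        (x∈p⇒suc∣p-x∣≡∣p∣ (union J S′) (∈union⁺ (j , j∈J , subst (u ∈_) (sym (replace-same S j F)) u∈F)))
        (s≤s (p⊆q⇒∣p∣≤∣q∣ sub))
        where
        sub : union J S - p ⊆ union J S′ - u
        sub {x} h with ∈union⁻ (x∈p-y⇒x∈p (union J S) h)
        ... | (c , c∈J , x∈c) = x∈p∧x≢y⇒x∈p-y (∈union⁺ (c , c∈J , x∈S′)) λ { refl → hole (c , c∈J , x∈c) }
          where
          x∈S′ : x ∈ S′ c
          x∈S′ with replace-view S j F c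
          ... | inj₂ (_ , e) = subst (x ∈_) (sym e) x∈c
          ... | inj₁ (refl , e) = subst (x ∈_) (sym e) (S⇒F x∈c (x∈p-y⇒x≢y (union J S) h))

      good′ : Good J S′
      good′ = record { edges = edges′ ; irredundant = irr′ ; distinct = distinct′ }
        where
        edges′ : ∀ c → c ∈ J → G (S′ c)
        edges′ c c∈J with replace-view S j F c
        ... | inj₁ (_ , e) = subst G (sym e) GF
        ... | inj₂ (_ , e) = subst G (sym e) (edges c c∈J)

        irr′ : Irredundant J S′
        irr′ c c∈J with replace-view S j F c
        -- The former hole `u` is the private point of the new block.
        ... | inj₁ (refl , e) = u , subst (u ∈_) (sym e) u∈F , only
          where
          only : ∀ d → d ∈ J → u ∈ S′ d → d ≡ c
          only d d∈J u∈d with replace-view S j F d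
          ... | inj₁ (refl , _) = refl
          ... | inj₂ (_ , e′) = contradiction (d , d∈J , subst (u ∈_) e′ u∈d) hole
        ... | inj₂ (c≢j , e) with irredundant c c∈J
        ... | (q , q∈c , only) = q , subst (q ∈_) (sym e) q∈c , only′
          where
          only′ : ∀ d → d ∈ J → q ∈ S′ d → d ≡ c
          only′ d d∈J q∈d with replace-view S j F d
          ... | inj₂ (_ , e′) = only d d∈J (subst (q ∈_) e′ q∈d)
          ... | inj₁ (_ , e′) = contradiction (sym (only j j∈J (x∈p-y⇒x∈p (S j)
                  (F⇒S (subst (q ∈_) e′ q∈d) λ { refl → hole (c , c∈J , q∈c) })))) c≢j

        apart : ∀ c → c ∈ J → ∀ q r → q ∈ S c → S c - q ≡ F - r → c ≡ j
        apart c c∈J q r q∈ e with u Fin.≟ r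
        ... | yes refl = distinct c j c∈J j∈J q p q∈ (proj₁ priv) (trans e (sym swap))
        ... | no u≢r = contradiction
                (c , c∈J , x∈p-y⇒x∈p (S c) (subst (u ∈_) (sym e) (x∈p∧x≢y⇒x∈p-y u∈F u≢r))) hole

        distinct′ : ∀ c d → c ∈ J → d ∈ J → ∀ q r → q ∈ S′ c → r ∈ S′ d → S′ c - q ≡ S′ d - r → c ≡ d
        distinct′ c d c∈J d∈J q r q∈ r∈ eq with replace-view S j F c | replace-view S j F d
        ... | inj₁ (refl , _) | inj₁ (refl , _) = refl
        ... | inj₁ (refl , e) | inj₂ (_ , e′) =
          sym (apart d d∈J r q (subst (r ∈_) e′ r∈) (trans (cong (_- r) (sym e′)) (trans (sym eq) (cong (_- q) e))))
        ... | inj₂ (_ , e) | inj₁ (refl , e′) =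
          apart c c∈J q r (subst (q ∈_) e q∈) (trans (cong (_- q) (sym e)) (trans eq (cong (_- r) e′)))
        ... | inj₂ (_ , e) | inj₂ (_ , e′) =
          distinct c d c∈J d∈J q r (subst (q ∈_) e q∈) (subst (r ∈_) e′ r∈)
            (trans (cong (_- q) (sym e)) (trans eq (cong (_- r) e′)))

  -- Sliding a hole while one block stays fixed.

  module Slide {m} {J : Subset m} {S : Fin m → Subset n} (good : Good J S) (max : Maximum J S)
               {i} (i∈J : i ∈ J) (Z : Subset n) (Z-miss : ∀ x → x ∈ S i → x ∉ Z)
               (Z-hit : ∀ F → G F → F ≢ S i → Meets F Z) {v} (v-hole : ¬ Covered J S v) where

    data Reach : (Fin m → Subset n) → Fin n → Set where
      start : Reach S v
      move  : ∀ {T u j p F} → Reach T u → j ∈ J → j ≢ i → Private J T j p → G F → u ∈ F →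
              T j - p ≡ F - u → Reach (replace T j F) p

    -- `covered`, `fresh` and `hole` track how the union changes as the hole travels. `linkTo` feeds
    -- the later `shrink`, while `linkFrom` shows that a reachable hole lies in at most one block of
    -- `S`.
    record Invariant (T : Fin m → Subset n) (u : Fin n) : Set where
      field
        good-T   : Good J T
        max-T    : Maximum J T
        hole     : ¬ Covered J T u
        covered  : ∀ {x} → Covered J T x → Covered J S x ⊎ x ≡ v
        fresh    : Covered J S u ⊎ u ≡ v
        linkTo   : Link J S T
        linkFrom : Link J T S
        fixed    : T i ≡ S i

    invariant : ∀ {T u} → Reach T u → Invariant T u
    invariant start = record
      { good-T = good ; max-T = max ; hole = v-hole ; covered = inj₁ ; fresh = inj₂ refl
      ; linkTo = λ _ _ _ h _ → h ; linkFrom = λ _ _ _ h _ → h ; fixed = refl }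
    invariant (move {T} {u} {j} {p} {F} r j∈J j≢i priv GF u∈F swap) = record
      { good-T = good′
      ; max-T = λ J′ S′ g → ≤-trans (max-T J′ S′ g) ∣union∣≤
      ; hole = new-hole
      ; covered = λ h → back (covered-before h)
      ; fresh = covered (j , j∈J , proj₁ priv)
      ; linkTo = Link-trans {S = S} {T = T} {U = S′} linkTo₀ M.linkTo
      ; linkFrom = Link-trans {S = S′} {T = T} {U = S} M.linkFrom linkFrom₀
      ; fixed = still }
      where
      open Invariant (invariant r) renaming (linkTo to linkTo₀; linkFrom to linkFrom₀)
      module M = Move good-T hole GF u∈F j∈J priv swap
      open M using (S′; good′; ∣union∣≤; new-hole; covered-before)
      back : ∀ {x} → Covered J T x ⊎ x ≡ u → Covered J S x ⊎ x ≡ v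
      back (inj₁ h) = covered h
      back (inj₂ refl) = fresh
      still : S′ i ≡ S i
      still with replace-view T j F i
      ... | inj₁ (refl , _) = contradiction refl j≢i
      ... | inj₂ (_ , e) = trans e fixed

    Q : Fin n → Set
    Q x = ∃ λ T → Reach T x

    -- Every exchange alters a block only at its two holes, and both are reachable.
    outside-Q : ∀ {T u} → Reach T u → ∀ {x} → ¬ Q x → ∀ j →
      (x ∈ T j → x ∈ S j) × (x ∈ S j → x ∈ T j)
    outside-Q start ¬Qx j = (λ h → h) , (λ h → h)
    outside-Q r₀@(move {T} {u} {j} {p} {F} r j∈J j≢i priv GF u∈F swap) {x} ¬Qx c
      with replace-view T j F c | outside-Q r ¬Qx c
    ... | inj₂ (_ , e) | (f , g) = (λ h → f (subst (x ∈_) e h)) , (λ h → subst (x ∈_) (sym e) (g h))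
    ... | inj₁ (refl , e) | (f , g) =
      (λ h → f (x∈p-y⇒x∈p (T j) (F⇒S (subst (x ∈_) e h) λ { refl → ¬Qx (_ , r) }))) ,
      (λ h → subst (x ∈_) (sym e) (S⇒F (g h) λ { refl → ¬Qx (_ , r₀) }))
      where
      open Invariant (invariant r)
      open Move good-T hole GF u∈F j∈J priv swap using (F⇒S; S⇒F)

    -- If no reachable hole lies in Z then Z meets every edge through a reachable
    -- hole outside Q.  A transversal missing only an edge at v can then trade its
    -- points of Q, block by block, for points of Z, and becomes a full
    -- transversal of size at most b.
    module Stuck (stuck : ∀ {T u} → Reach T u → u ∉ Z) (Q? : ∀ x → Dec (Q x)) where

      Q∉S : ∀ {q} → Q q → q ∉ S i
      Q∉S {q} (T , r) q∈S = hole (i , i∈J , subst (q ∈_) (sym fixed) q∈S)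
        where open Invariant (invariant r)

      Q-single : ∀ {q j l} → Q q → j ∈ J → l ∈ J → q ∈ S j → q ∈ S l → l ≡ j
      Q-single {q} {j} {l} (T , r) j∈J l∈J q∈j q∈l with l Fin.≟ j
      ... | yes e = e
      ... | no l≢j = contradiction (l , l∈J , linkFrom l∈J j∈J l≢j q∈l q∈j) hole
        where open Invariant (invariant r)

      SameOutsideQ : Subset n → Subset n → Set
      SameOutsideQ p q = ∀ x → ¬ Q x → (x ∈ p → x ∈ q) × (x ∈ q → x ∈ p)

      -- `exchange` matches `F` with a block of `T` up to two points. If the block is not `i`, both
      -- points are reachable. If it is `i`, then `F` without `q` lies in `S i`, so `Z` could meet
      -- `F` only in `q`, which `stuck` forbids.
      block-of : ∀ {q F} → Q q → G F → q ∈ F → ∃ λ j → j ∈ J × SameOutsideQ F (S j)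
      block-of {q} {F} (T , r) GF q∈F with exchange good-T max-T hole GF q∈F
        where open Invariant (invariant r)
      ... | (j , j∈J , p , priv , swap) with j Fin.≟ i
      ... | no j≢i = j , j∈J , λ x ¬Qx → let (f , g) = outside-Q r ¬Qx j in
            (λ x∈F → f (x∈p-y⇒x∈p (T j) (F⇒S x∈F λ { refl → ¬Qx (T , r) }))) ,
            (λ x∈S → S⇒F (g x∈S) λ { refl → ¬Qx (_ , move r j∈J j≢i priv GF q∈F swap) })
        where
        open Invariant (invariant r)
        open Move good-T hole GF q∈F j∈J priv swap using (F⇒S; S⇒F)
      ... | yes refl =
        let (x , x∈F , x∈Z) = Z-hit F GF λ { refl → Q∉S (T , r) q∈F } in
        ⊥-elim (Z-miss x (subst (x ∈_) fixed (x∈p-y⇒x∈p (T j) (F⇒S x∈F λ x≡q → stuck r (subst (_∈ Z) x≡q x∈Z)))) x∈Z)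
        where
        open Invariant (invariant r)
        open Move good-T hole GF q∈F j∈J priv swap using (F⇒S)

      absurd : Empty.⊥
      absurd =
        let (F₀ , GF₀ , v∈F₀) = spanning v
            (X , ∣X∣≤b , _ , X-hit) = critical GF₀
            (Y , ∣Y∣≤∣X∣ , to , _) = image-choice X R (total X)
        in no-transversal Y (≤-trans ∣Y∣≤∣X∣ ∣X∣≤b) (meets F₀ v∈F₀ X X-hit Y to)
        where
        R : Fin n → Fin n → Set
        -- A point outside `Q` is kept. A point of `Q` in block `j` is traded for a point of `S j`
        -- in `Z` outside `Q`; if there is none, the second clause is vacuous, as such an `F` cannot
        -- meet `Z`.
        R x y = ∀ F → (¬ Q x → x ∈ F → y ∈ F) ×
                      (Q x → ∀ j → j ∈ J → x ∈ S j → SameOutsideQ F (S j) → Meets F Z → y ∈ F)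

        total : ∀ X x → x ∈ X → ∃ (R x)
        total _ x _ with Q? x
        ... | no ¬Qx = x , λ F → (λ _ x∈F → x∈F) , λ Qx → contradiction Qx ¬Qx
        ... | yes Qx with Fin.any? (λ j → (j ∈? J) ×-dec ((x ∈? S j) ×-dec
                            Fin.any? (λ z → (z ∈? S j) ×-dec (¬? (Q? z) ×-dec (z ∈? Z)))))
        ... | yes (j , j∈J , x∈j , z , z∈j , ¬Qz , z∈Z) = z , λ F → (λ ¬Qx → contradiction Qx ¬Qx) ,
              λ _ l l∈J x∈l same _ →
                proj₂ (same z ¬Qz) (subst (λ t → z ∈ S t) (sym (Q-single Qx j∈J l∈J x∈j x∈l)) z∈j)
        ... | no none = x , λ F → (λ ¬Qx → contradiction Qx ¬Qx) ,
              λ { _ l l∈J x∈l same (z , z∈F , z∈Z) →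
                let ¬Qz = λ Qz → stuck (proj₂ Qz) z∈Z in
                contradiction (l , l∈J , x∈l , z , proj₁ (same z ¬Qz) z∈F , ¬Qz , z∈Z) none }

        meets : ∀ F₀ → v ∈ F₀ → ∀ X → (∀ F → G F → F ≢ F₀ → Meets F X) → ∀ Y →
          (∀ x → x ∈ X → ∃ λ y → y ∈ Y × R x y) → ∀ F → G F → Meets F Y
        meets F₀ v∈F₀ X X-hit Y to F GF with Fin.any? (λ q → (q ∈? F) ×-dec Q? q)
        ... | no none =
          let (x , x∈F , x∈X) = X-hit F GF λ { refl → none (v , v∈F₀ , S , start) }
              (y , y∈Y , r) = to x x∈X
          in y , proj₁ (r F) (λ Qx → none (x , x∈F , Qx)) x∈F , y∈Y
        ... | yes (q , q∈F , Qq) with block-of Qq GF q∈F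
        -- `F` may be `F₀` itself, which `X` need not meet, so `X` is applied to the block `S j`;
        -- that block differs from `F₀` because `v` is uncovered.
        ... | (j , j∈J , same) with X-hit (S j) (Good.edges good j j∈J) (λ { refl → v-hole (j , j∈J , v∈F₀) })
        ... | (x , x∈S , x∈X) with to x x∈X | Q? x
        ... | (y , y∈Y , r) | no ¬Qx = y , proj₁ (r F) ¬Qx (proj₂ (same x ¬Qx) x∈S) , y∈Y
        ... | (y , y∈Y , r) | yes Qx = y , proj₂ (r F) Qx j j∈J x∈S same
                (Z-hit F GF λ { refl → Q∉S Qq q∈F }) , y∈Y

    slide : ¬ ¬ (∃₂ λ T u → Reach T u × u ∈ Z)
    slide κ = ¬¬-∀-Fin {P = λ x → Dec (Q x)} (λ _ → ¬¬-Dec) λ Q? →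
      Stuck.absurd (λ {T} {u} r u∈Z → κ (T , u , r , u∈Z)) Q?

  -- A hole outside `Z` is slid to some `u ∈ Z`. Only `v ∉ Z` can become newly covered, while `u`
  -- becomes uncovered, so the covered part of `Z` shrinks and the process ends.
  holes-into : ∀ {m} {J : Subset m} {i} → i ∈ J → ∀ {E} (Z : Subset n) → (∀ x → x ∈ E → x ∉ Z) →
    (∀ F → G F → F ≢ E → Meets F Z) → ∀ c {S} → Good J S → Maximum J S → S i ≡ E →
    ∣ union J S ∩ Z ∣ < c →
    ¬ ¬ (∃ λ T → Good J T × Maximum J T × Link J S T × T i ≡ E × (∀ v → ¬ Covered J T v → v ∈ Z))
  holes-into {J = J} {i} i∈J Z miss hit (suc c) {S} good max refl (s≤s lt) κ
    with Fin.any? (λ v → ¬? (covered? J S v) ×-dec ¬? (v ∈? Z))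
  ... | no none = κ (S , good , max , (λ _ _ _ h _ → h) , refl , into)
    where
    into : ∀ v → ¬ Covered J S v → v ∈ Z
    into v hole with v ∈? Z
    ... | yes v∈Z = v∈Z
    ... | no v∉Z = contradiction (v , hole , v∉Z) none
  ... | yes (v , v-hole , v∉Z) = slide λ (T , u , r , u∈Z) → rest T u (invariant r) u∈Z
    where
    open Slide good max i∈J Z miss hit v-hole
    rest : ∀ T u → Invariant T u → u ∈ Z → Empty.⊥
    rest T u inv u∈Z = holes-into i∈J Z miss hit c good-T max-T fixed (≤-trans (p⊂q⇒∣p∣<∣q∣ smaller) lt)
      λ { (T′ , good″ , max″ , link , e , into) →
          κ (T′ , good″ , max″ , Link-trans {S = S} {T = T} {U = T′} linkTo link , e , into) }
      where
      open Invariant inv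
      u∈S : Covered J S u ⊎ u ≡ v → u ∈ union J S
      u∈S (inj₁ h) = ∈union⁺ h
      u∈S (inj₂ refl) = contradiction u∈Z v∉Z
      smaller : (union J T ∩ Z) ⊂ (union J S ∩ Z)
      smaller = sub , u , x∈p∩q⁺ (u∈S fresh , u∈Z) , λ h → hole (∈union⁻ (p∩q⊆p (union J T) Z h))
        where
        old : ∀ {x} → x ∈ Z → Covered J S x ⊎ x ≡ v → x ∈ union J S
        old x∈Z (inj₁ h) = ∈union⁺ h
        old x∈Z (inj₂ refl) = contradiction x∈Z v∉Z
        sub : union J T ∩ Z ⊆ union J S ∩ Z
        sub h = let (p , q) = x∈p∩q⁻ (union J T) Z h in x∈p∩q⁺ (old q (covered (∈union⁻ p)) , q)

-- The bound on the order.

module _ {n a b : ℕ} {G : Subset n → Set} (crit : CriticalTransversal (suc a) b G) where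

  open CriticalTransversal crit

  module _ {m} {J : Subset m} {S : Fin m → Subset n} (good : Good crit J S) (max : Maximum crit J S)
           {D : Fin m → Subset n} (trunc : ∀ j → j ∈ J → ∃ λ p → Private J S j p × D j ≡ S j - p) where

    private
      open Good good
      U = union J S
      h = ∣ ∁ U ∣

      D-distinct : ∀ i j → i ∈ J → j ∈ J → D i ≡ D j → i ≡ j
      D-distinct i j i∈J j∈J e =
        let (p , (p∈ , _) , e₁) = trunc i i∈J
            (q , (q∈ , _) , e₂) = trunc j j∈J
        in distinct i j i∈J j∈J p q p∈ q∈ (trans (sym e₁) (trans e e₂))

      sizes : ∀ j → j ∈ J → ∣ S j ∣ ≡ suc (suc a)
      sizes j j∈J = size (edges j j∈J)

      -- Supplies the set opposite `D i` in the set-pair system; `h ≤ b` is carried along because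
      -- `b ∸ h` is truncated.
      Partner : Fin m → Set
      Partner i = i ∈ J → h ≤ b × ∃ λ Y → ∣ Y ∣ ≤ b ∸ h × (∀ x → x ∈ D i → x ∉ Y) ×
                    (∀ j → j ∈ J → j ≢ i → ∃ λ x → x ∈ D j × x ∈ Y)

      partner : ∀ i → ¬ ¬ Partner i
      partner i κ with i ∈? J
      ... | no i∉J = κ λ i∈J → contradiction i∈J i∉J
      ... | yes i∈J =
        let (Z , ∣Z∣≤b , miss , hit) = critical (edges i i∈J) in
        holes-into crit i∈J Z miss hit (suc ∣ U ∩ Z ∣) good max refl ≤-refl
          λ { (T , good-T , max-T , link , fixed , into) →
              κ λ _ → build Z ∣Z∣≤b miss hit T good-T max-T link fixed into }
        where
        build : ∀ Z → ∣ Z ∣ ≤ b → (∀ x → x ∈ S i → x ∉ Z) → (∀ F → G F → F ≢ S i → Meets F Z) →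
          ∀ T → Good crit J T → Maximum crit J T → Link J S T → T i ≡ S i →
          (∀ v → ¬ Covered J T v → v ∈ Z) →
          h ≤ b × ∃ λ Y → ∣ Y ∣ ≤ b ∸ h × (∀ x → x ∈ D i → x ∉ Y) ×
                    (∀ j → j ∈ J → j ≢ i → ∃ λ x → x ∈ D j × x ∈ Y)
        build Z ∣Z∣≤b miss hit T good-T max-T link fixed into =
          let (Y , le , miss′ , hit′) = shrink sizes trunc D-distinct link i∈J fixed (Z ∩ UT)
                (λ x x∈S x∈ → miss x x∈S (p∩q⊆p Z UT x∈)) hit-T
          in m+n≤o⇒n≤o ∣ Z ∩ UT ∣ total , Y , ≤-trans le (m+n≤o⇒m≤o∸n ∣ Z ∩ UT ∣ total) , miss′ , hit′
          where
          UT = union J T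
          -- Both families are maximum, so `T` also has exactly `h` holes, and all of them occupy
          -- points of `Z`.
          ∣UT∣≡∣U∣ : ∣ UT ∣ ≡ ∣ U ∣
          ∣UT∣≡∣U∣ = ≤-antisym (max J T good-T) (max-T J S good)
          h≡ : h ≡ ∣ ∁ UT ∣
          h≡ = trans (∣∁p∣≡n∸∣p∣ U) (trans (cong (n ∸_) (sym ∣UT∣≡∣U∣)) (sym (∣∁p∣≡n∸∣p∣ UT)))
          holes⊆Z : ∁ UT ⊆ Z ∩ ∁ UT
          holes⊆Z {x} x∈ = x∈p∩q⁺ (into x (λ c → x∈∁p⇒x∉p x∈ (∈union⁺ c)) , x∈)
          total : ∣ Z ∩ UT ∣ + h ≤ b
          total = begin
            ∣ Z ∩ UT ∣ + h              ≡⟨ cong (∣ Z ∩ UT ∣ +_) h≡ ⟩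
            ∣ Z ∩ UT ∣ + ∣ ∁ UT ∣       ≤⟨ +-monoʳ-≤ ∣ Z ∩ UT ∣ (p⊆q⇒∣p∣≤∣q∣ holes⊆Z) ⟩
            ∣ Z ∩ UT ∣ + ∣ Z ∩ ∁ UT ∣   ≡⟨ ∣p∩q∣+∣p∩∁q∣≡∣p∣ Z UT ⟩
            ∣ Z ∣                       ≤⟨ ∣Z∣≤b ⟩
            b ∎
            where open ≤-Reasoning
          hit-T : ∀ j → j ∈ J → j ≢ i → ∃ λ x → x ∈ T j × x ∈ Z ∩ UT
          hit-T j j∈J j≢i =
            let (x , x∈T , x∈Z) = hit (T j) (Good.edges good-T j j∈J) λ e →
                  j≢i (irredundant⇒distinct (Good.irredundant good-T) j i j∈J i∈J (trans e (sym fixed)))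
            in x , x∈T , x∈p∩q⁺ (x∈Z , ∈union⁺ (j , j∈J , x∈T))

    -- The vertices are the `h` holes, one removed point per block and the union of the truncations.
    -- The last two are bounded with parameter `b ∸ h`; raising it to `b` absorbs the holes.
    few-vertices : ∀ {i} → i ∈ J → ¬ ¬ (n < ((suc a + b) C suc a) + (suc (suc a + b) C suc a))
    few-vertices {i} i∈J κ = ¬¬-∀-Fin partner λ partners → κ (count partners)
      where
      count : (∀ i → Partner i) → n < ((suc a + b) C suc a) + (suc (suc a + b) C suc a)
      count partners = begin-strict
        n                                       ≡⟨ sym (trans (cong (_+ ∣ U ∣) (∣∁p∣≡n∸∣p∣ U)) (m∸n+n≡m (∣p∣≤n U))) ⟩
        h + ∣ U ∣                               ≤⟨ +-monoʳ-≤ h (∣union∣≤∣J∣+∣union∣ J S D λ j j∈ → let (p , _ , e) = trunc j j∈ in p , e) ⟩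
        h + (∣ J ∣ + ∣ union J D ∣)             ≡⟨ sym (+-assoc h ∣ J ∣ _) ⟩
        h + ∣ J ∣ + ∣ union J D ∣               ≤⟨ +-monoˡ-≤ _ (+-monoʳ-≤ h (bollobás ∣D∣ ∣Y∣≤ pairs)) ⟩
        h + ((suc a + β) C suc a) + ∣ union J D ∣
          <⟨ +-monoʳ-< (h + ((suc a + β) C suc a)) (∣union∣<C (suc a) β ∣D∣ ∣Y∣≤ pairs) ⟩
        h + ((suc a + β) C suc a) + (suc (suc a + β) C suc a)
          ≤⟨ +-mono-≤ (+C≤C h (≤-trans (n≤1+n a) (m≤m+n (suc a) β))) (C-grow h (suc (suc a + β)) (suc a)) ⟩
        ((h + (suc a + β)) C suc a) + ((h + suc (suc a + β)) C suc a)
          ≡⟨ cong₂ (λ s t → (s C suc a) + (t C suc a)) h+ (trans (+-suc h (suc a + β)) (cong suc h+)) ⟩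
        ((suc a + b) C suc a) + (suc (suc a + b) C suc a) ∎
        where
        open ≤-Reasoning
        β = b ∸ h
        h≤b = proj₁ (partners i i∈J)
        rearrange : ∀ x y z → x + (y + z) ≡ y + (x + z)
        rearrange = solve-∀
        h+ : h + (suc a + β) ≡ suc a + b
        h+ = trans (rearrange h (suc a) β) (cong (suc a +_) (m+[n∸m]≡n h≤b))
        Y-spec = choice-on ⊥ J (λ i Y → ∣ Y ∣ ≤ b ∸ h × (∀ x → x ∈ D i → x ∉ Y) ×
                    (∀ j → j ∈ J → j ≢ i → ∃ λ x → x ∈ D j × x ∈ Y)) (λ i i∈ → proj₂ (partners i i∈))
        Y = proj₁ Y-spec
        ∣Y∣≤ : ∀ i → i ∈ J → ∣ Y i ∣ ≤ β
        ∣Y∣≤ i i∈ = proj₁ (proj₂ Y-spec i i∈)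
        ∣D∣ : ∀ i → i ∈ J → ∣ D i ∣ ≡ suc a
        ∣D∣ = ∣D∣≡a sizes trunc D-distinct
        pairs : IntersectingPairs J D Y
        pairs = (λ i i∈ → proj₁ (proj₂ (proj₂ Y-spec i i∈))) ,
                (λ i j i∈ j∈ i≢j → proj₂ (proj₂ (proj₂ Y-spec j j∈)) i i∈ i≢j)

  order-bound : Fin n → ¬ ¬ (n < ((suc a + b) C suc a) + (suc (suc a + b) C suc a))
  order-bound v κ = ¬¬-maximum crit λ { (m , J , S , good , max) →
    let (i , i∈J) = block good max
        (D , trunc) = choice-on ⊥ J (λ j D → ∃ λ p → Private J S j p × D ≡ S j - p)
          (λ j j∈ → let (p , priv) = Good.irredundant good j j∈ in S j - p , p , priv , refl)
    in few-vertices good max trunc i∈J κ }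
    where
    -- A maximum family has a block: either `v` is covered or `exchange` yields one.
    block : ∀ {m} {J : Subset m} {S} → Good crit J S → Maximum crit J S → ∃ λ i → i ∈ J
    block {J = J} {S} good max with covered? J S v
    ... | yes (i , i∈J , _) = i , i∈J
    ... | no hole = let (F , GF , v∈F) = spanning v
                        (i , i∈J , _) = exchange crit good max hole GF v∈F
                    in i , i∈J

-- From saturation to critical transversals.

pad : ∀ (p : Subset n) {c} → ∣ p ∣ ≤ c → c ≤ n → ∃ λ q → p ⊆ q × ∣ q ∣ ≡ c
pad [] {zero} _ _ = [] , (λ h → h) , refl
pad (inside ∷ p) {suc c} (s≤s le) (s≤s c≤n) =
  let (q , p⊆q , e) = pad p le c≤n in inside ∷ q , s⊆s p⊆q , cong suc e
pad {suc n} (outside ∷ p) {c} le c≤n with c ≤? n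
... | yes c≤ = let (q , p⊆q , e) = pad p le c≤ in outside ∷ q , s⊆s p⊆q , e
... | no c≰ = ⊤ , ⊆-max _ , trans (∣⊤∣≡n (suc n)) (≤-antisym (≰⇒> c≰) c≤n)

NonEdge : ℕ → Hypergraph n → Subset n → Set
NonEdge k H F = ∣ F ∣ ≡ k × ¬ H F

-- Complements turn cliques on `n ∸ ℓ` vertices into transversals of the non-edges. The witness for
-- `F` is the complement of the clique created by adding `F`; it misses `F`, or it would be a
-- transversal of all non-edges.
non-edges-critical : ∀ {a ℓ n} {H : Hypergraph n} → (∀ T → Dec (H T)) → suc a < n ∸ ℓ →
  PrimitiveUniquelySaturated (suc a) (n ∸ ℓ) H → CriticalTransversal a ℓ (NonEdge (suc a) H)
non-edges-critical {a} {ℓ} {n} {H} H? k<r ((no-clique , unique) , undominated) = record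
  { size = proj₁
  ; no-transversal = no-transversal
  ; critical = λ {F} → critical F
  ; spanning = spanning }
  where
  ℓ≤n : ℓ ≤ n
  ℓ≤n with ℓ ≤? n
  ... | yes le = le
  ... | no ≰ = contradiction (subst (suc a <_) (m≤n⇒m∸n≡0 (<⇒≤ (≰⇒> ≰))) k<r) λ ()

  no-transversal : ∀ X → ∣ X ∣ ≤ ℓ → ¬ (∀ F → NonEdge (suc a) H F → Meets F X)
  no-transversal X le hit =
    let (X′ , X⊆ , e) = pad X le ℓ≤n in
    no-clique (∁ X′ , trans (∣∁p∣≡n∸∣p∣ X′) (cong (n ∸_) e) , λ T T⊆ ∣T∣ → edge X′ X⊆ T T⊆ ∣T∣)
    where
    edge : ∀ X′ → X ⊆ X′ → ∀ T → T ⊆ ∁ X′ → ∣ T ∣ ≡ suc a → H T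
    edge X′ X⊆ T T⊆ ∣T∣ with H? T
    ... | yes HT = HT
    ... | no ¬HT = let (x , x∈T , x∈X) = hit T (∣T∣ , ¬HT) in contradiction (X⊆ x∈X) (x∈∁p⇒x∉p (T⊆ x∈T))

  critical : ∀ F → NonEdge (suc a) H F → ∃ λ X → ∣ X ∣ ≤ ℓ × (∀ x → x ∈ F → x ∉ X) ×
               (∀ F′ → NonEdge (suc a) H F′ → F′ ≢ F → Meets F′ X)
  critical F (∣F∣ , ¬HF) with unique F ∣F∣ ¬HF
  ... | (R , (∣R∣ , clique) , _) = ∁ R , ∣∁R∣≤ℓ , miss , hit
    where
    ∣∁R∣≤ℓ : ∣ ∁ R ∣ ≤ ℓ
    ∣∁R∣≤ℓ = ≤-reflexive (trans (∣∁p∣≡n∸∣p∣ R) (trans (cong (n ∸_) ∣R∣) (m∸[m∸n]≡n ℓ≤n)))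
    hit : ∀ F′ → NonEdge (suc a) H F′ → F′ ≢ F → Meets F′ (∁ R)
    hit F′ (∣F′∣ , ¬HF′) F′≢F =
      let (x , x∈ , x∉) = p⊈q⇒∃ F′ R not-inside in x , x∈ , x∉p⇒x∈∁p x∉
      where
      not-inside : ¬ F′ ⊆ R
      not-inside sub with clique F′ sub ∣F′∣
      ... | inj₁ HF′ = ¬HF′ HF′
      ... | inj₂ e = F′≢F e
    miss : ∀ x → x ∈ F → x ∉ ∁ R
    miss x x∈F x∈∁R = no-transversal (∁ R) ∣∁R∣≤ℓ all-hit
      where
      all-hit : ∀ F′ → NonEdge (suc a) H F′ → Meets F′ (∁ R)
      all-hit F′ ne with F′ ≟ˢ F
      ... | yes refl = x , x∈F , x∈∁R
      ... | no F′≢F = hit F′ ne F′≢F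

  spanning : ∀ v → ∃ λ F → NonEdge (suc a) H F × v ∈ F
  spanning v with anySubset? (λ F → ((∣ F ∣ ≟ suc a) ×-dec ¬? (H? F)) ×-dec (v ∈? F))
  ... | yes w = w
  ... | no none = ⊥-elim (undominated v dominating)
    where
    dominating : Dominating (suc a) H v
    dominating T ∣T∣ v∈T with H? T
    ... | yes HT = HT
    ... | no ¬HT = contradiction (T , (∣T∣ , ¬HT) , v∈T) none

theorem5 : (k ℓ n : ℕ) → 2 ≤ k → 1 ≤ ℓ →
    ((k + ℓ) C (k ∸ 1)) + ((k + ℓ ∸ 1) C (k ∸ 1)) ≤ n →
    k < n ∸ ℓ →
    (H : Hypergraph n) → ¬ PrimitiveUniquelySaturated k (n ∸ ℓ) H
-- The case `n = 0` contradicts `k < n ∸ ℓ`; otherwise the vertex `zero` is available for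
-- `order-bound`.
theorem5 (suc (suc a)) ℓ zero _ _ _ k<r _ _ = contradiction (subst (suc (suc a) <_) (0∸n≡0 ℓ) k<r) λ ()
theorem5 (suc (suc a)) ℓ n@(suc _) _ _ bound k<r H sat =
  -- The goal is a negation, so the edge predicate may be taken as decidable.
  ¬¬-∀-Subset {P = λ T → Dec (H T)} (λ _ → ¬¬-Dec) λ H? →
    order-bound (non-edges-critical H? k<r sat) zero λ lt →
      <⇒≱ lt (subst (_≤ n) (+-comm (suc (suc a + ℓ) C suc a) _) bound)
theorem5 (suc zero) _ _ (s≤s ())
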